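{- Let $$\mathrm{S2}(z,q)=\sum_{n=1}^\infty\frac{q^{2n}(q^{2n+2};q^2)_\infty(-q^{2n+1};q^2)_\infty}{(zq^{2n};q^2)_\infty(z^{ -1}q^{2n};q^2)_\infty}.$$ Then, in $\mathbb{Z}[z,z^{ -1}][[q]]$, $$(z;q^2)_\infty(z^{ -1};q^2)_\infty(q^2;q^2)_\infty\,\mathrm{S2}(z,-q)=\sum_{n=0}^\infty\sum_{m=0}^n(-1)^n(1-z^{n-m})^2z^{m-n}q^{\frac12(2n^2-m^2)+\frac12(2n-m)}.$$
   Context: Notation: $(a;q^2)_\infty=\prod_{k\ge 0}(1-aq^{2k})$. $\mathrm{S2}(z,-q)$ is obtained from $\mathrm{S2}(z,q)$ by replacing $q$ by $-q$. $\mathrm{S2}(z,q)$ is the generating function of the spt-crank for partitions with distinct odd parts and smallest part even. -}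

module Defs where

open import Algebra.Bundles.Raw using (RawRing)
import Algebra.Definitions.RawSemiring as RawSemiringDefs
open import Data.Bool.Base using (if_then_else_)
open import Data.Fin.Base using (toℕ)
open import Data.Integer.Base as ℤ using (ℤ; +_; 0ℤ; 1ℤ; -1ℤ)
import Data.Integer.Properties as ℤ
open import Data.List.Base using (List; []; _∷_; [_]; _++_; map; cartesianProductWith)
open import Data.Nat.Base as ℕ using (ℕ; zero; suc; _∸_)
import Data.Nat.Properties as ℕ
open import Data.Product.Base using (_×_; _,_)
open import Level using (0ℓ)
open import Relation.Binary.PropositionalEquality.Core using (_≡_)
open import Relation.Nullary.Decidable.Core using (does)

------------------------------------------------------------------------
-- Finite sums and products in a ring

module Ring {c ℓ} (R : RawRing c ℓ) where
  open RawRing R public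
  open RawSemiringDefs rawSemiring public using (sum; product; _^_)

  infixl 6 _-_
  _-_ : Carrier → Carrier → Carrier
  x - y = x + (- y)

  -- f 0 + … + f n  and  f 0 * … * f n, both bounds included.
  ∑≤ ∏≤ : ℕ → (ℕ → Carrier) → Carrier
  ∑≤ n f = sum     {suc n} (λ i → f (toℕ i))
  ∏≤ n f = product {suc n} (λ i → f (toℕ i))

------------------------------------------------------------------------
-- The ring R[[q]]

module PowerSeries {c ℓ} (R : RawRing c ℓ) where
  private module R = Ring R

  -- f n is the coefficient of qⁿ.
  Series : Set c
  Series = ℕ → R.Carrier

  -- a q^ n is the series a·qⁿ.
  infix 9 _q^_
  _q^_ : R.Carrier → ℕ → Series
  (a q^ n) k = if does (n ℕ.≟ k) then a else R.0#

  rawRing : RawRing c ℓ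
  rawRing = record
    { Carrier = Series
    ; _≈_     = λ f g → ∀ n → f n R.≈ g n
    ; _+_     = λ f g n → f n R.+ g n
    ; _*_     = λ f g n → R.∑≤ n (λ i → f i R.* g (n ∸ i))
    ; -_      = λ f n → R.- f n
    ; 0#      = λ _ → R.0#
    ; 1#      = R.1# q^ 0
    }

  open Ring rawRing public

  -- The substitution q ↦ -q.
  infix 9 _[-q]
  _[-q] : Series → Series
  (f [-q]) n = ((R.- R.1#) R.^ n) R.* f n

  -- Infinite sums and products are q-adic limits of the partial sums and
  -- products.  They are only used when t n is divisible by qⁿ, resp. t n
  -- is congruent to 1 modulo qⁿ, for every n.  The coefficient of qᴺ in the
  -- partial sums and products is then unaffected by the terms with n > N, so
  -- that its limit is its value at the partial sum or product with index N.
  ∑∞ ∏∞ : (ℕ → Series) → Series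
  ∑∞ t N = ∑≤ N t N
  ∏∞ t N = ∏≤ N t N

  -- The geometric series for 1/f.  It is only used when f has constant
  -- coefficient 1, so that (1 - f)ᵏ is divisible by qᵏ and f * (f ⁻¹) = 1.
  infix 9 _⁻¹
  _⁻¹ : Series → Series
  f ⁻¹ = ∑∞ (λ k → (1# - f) ^ k)

  infixl 7 _/_
  _/_ : Series → Series → Series
  f / g = f * (g ⁻¹)

  -- (a;q²)_∞
  [_⨾q²]∞ : Series → Series
  [ a ⨾q²]∞ = ∏∞ (λ k → 1# - a * (R.1# q^ (2 ℕ.* k)))

------------------------------------------------------------------------
-- The ring ℤ[z,z⁻¹]

-- A Laurent polynomial is a formal sum of monomials: the entry (c , k) stands
-- for c·zᵏ.  Exponents may occur repeatedly and in any order; two formal sums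
-- are equal when all their collected coefficients agree.
Laurent : Set
Laurent = List (ℤ × ℤ)

coeff : Laurent → ℤ → ℤ
coeff []            k = 0ℤ
coeff ((c , i) ∷ p) k = (if does (i ℤ.≟ k) then c else 0ℤ) ℤ.+ coeff p k

ℤ[z^±1] : RawRing 0ℓ 0ℓ
ℤ[z^±1] = record
  { Carrier = Laurent
  ; _≈_     = λ p r → ∀ k → coeff p k ≡ coeff r k
  ; _+_     = _++_
  ; _*_     = cartesianProductWith (λ (c , i) (d , j) → c ℤ.* d , i ℤ.+ j)
  ; -_      = map (λ (c , k) → ℤ.- c , k)
  ; 0#      = []
  ; 1#      = [ 1ℤ , 0ℤ ]
  }

------------------------------------------------------------------------
-- The ring ℤ[z,z⁻¹][[q]] and the series S2(z,q)

open PowerSeries ℤ[z^±1] public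

infix 9 z^_ q^_

z^_ : ℤ → Series
z^ k = [ 1ℤ , k ] q^ 0

q^_ : ℕ → Series
q^ n = [ 1ℤ , 0ℤ ] q^ n

z z⁻¹ : Series
z   = z^ 1ℤ
z⁻¹ = z^ -1ℤ

S2-term : ℕ → Series
S2-term n =
  (q^ (2 ℕ.* n) * [ q^ (2 ℕ.* n ℕ.+ 2) ⨾q²]∞ * [ - q^ (2 ℕ.* n ℕ.+ 1) ⨾q²]∞)
  / ([ z * q^ (2 ℕ.* n) ⨾q²]∞ * [ z⁻¹ * q^ (2 ℕ.* n) ⨾q²]∞)

-- The sum starts at n = 1: for n = 0 the denominator has constant
-- coefficient (1 - z)(1 - z⁻¹), which is not invertible.
S2 : Series
S2 = ∑∞ (λ k → S2-term (suc k))

-- (2n² - m²)/2 + (2n - m)/2.  The two halves need not be integers separately,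
-- but their sum is n² + n - m(m+1)/2; for m ≤ n no subtraction truncates and
-- the division is exact.
exponent : ℕ → ℕ → ℕ
exponent n m = ((2 ℕ.* n ℕ.^ 2 ∸ m ℕ.^ 2) ℕ.+ (2 ℕ.* n ∸ m)) ℕ./ 2

module Submission where

-- Put p = q². After multiplication by (z;p)_∞(z⁻¹;p)_∞(p;p)_∞ the left-hand side is
--   (p;p)_∞ Σ_{n≥1} pⁿ uₙ (q²ⁿ⁺¹;q)_∞   with   uₙ = (z;p)ₙ(z⁻¹;p)ₙ,
-- and uₙ is a combination, with coefficients given by q-factorials, of the Laurent
-- polynomials zᵏ + z⁻ᵏ - 2 for 1 ≤ k ≤ n.  The coefficient of zᵏ + z⁻ᵏ - 2 on the left
-- satisfies a first-order recurrence in k, found by creative telescoping over n.  The partial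
-- theta function fₖ = Σ_m (-1)ᵐ q^(m(m+1)/2+2km) on the right satisfies the same one,
-- fₖ = 1 - q²ᵏ⁺¹ + q⁴ᵏ⁺³ fₖ₊₁, and such a recurrence has only one solution.
-- All this takes place modulo qᴺ⁺¹, where q is nilpotent and every sum and product is finite.

open import Defs using (Laurent; coeff; ℤ[z^±1]; exponent; module PowerSeries)
open import Algebra.Bundles using (CommutativeRing; Semiring)
open import Algebra.Bundles.Raw using (RawRing)
import Algebra.Definitions.RawSemiring
import Algebra.Properties.AbelianGroup
import Algebra.Properties.Ring
import Algebra.Properties.Semiring.Exp
import Algebra.Properties.Semiring.Mult.TCOptimised
import Algebra.Solver.Ring
open import Algebra.Solver.Ring.AlmostCommutativeRing
  using (fromCommutativeRing; _-Raw-AlmostCommutative⟶_)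
open import Data.Bool.Base using (if_then_else_; true; false)
open import Data.Fin.Base using (toℕ)
open import Data.Integer.Base as ℤ using (ℤ; +_; -[1+_]; 0ℤ; 1ℤ; -1ℤ)
import Data.Integer.Properties as ℤ
open import Data.Integer.Tactic.RingSolver using () renaming (solve-∀ to ℤ-solve-∀)
open import Data.List.Base using ([]; _∷_; [_]; _++_; map)
open import Data.List.Properties using (++-assoc; ++-identityʳ)
open import Data.Maybe.Base using (just; nothing)
open import Data.Nat.Base as ℕ
  using (ℕ; zero; suc; _∸_; _≤_; _<_; z≤n; s≤s; s<s)
open import Data.Nat.DivMod using (m*n/n≡m)
import Data.Nat.Properties as ℕ
open import Data.Nat.Tactic.RingSolver using () renaming (solve-∀ to ℕ-solve-∀)
open import Data.Product.Base using (_,_)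
open import Data.Sum.Base using (inj₁; inj₂)
open import Function.Base using (_∘_)
open import Level using (0ℓ)
open import Relation.Binary.Definitions using (WeaklyDecidable; tri<; tri≈; tri>)
open import Relation.Binary.PropositionalEquality as ≡ using (_≡_)
import Relation.Binary.Reasoning.Setoid
open import Relation.Binary.Structures using (IsEquivalence)
open import Relation.Nullary.Decidable.Core using (yes; no; does)
open import Relation.Nullary.Negation.Core using (contradiction)

-- First order is possible because of a cancellation. The coefficient of zᵏ in uₙ is (-1)ᵏ
-- p^(k(k-1)/2) (1 + pᵏ)(1 - pⁿ)(p;p)₂ₙ₋₁ / ((p;p)ₙ₋ₖ (p;p)ₙ₊ₖ). Times (q²ⁿ⁺¹;q)_∞, the factors free
-- of k collapse to (q;q)_∞ (-q;q)₂ₙ₋₁, whose ratio in n is just (1 + q²ⁿ)(1 + q²ⁿ⁺¹). The constant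
-- term has to go because at k = 0 the telescoped sum has a nonzero lower end. As uₙ vanishes at z =
-- 1, one may pass to zᵏ + z⁻ᵏ - 2 = (1 - zᵏ)² z⁻ᵏ, which is 0 for k = 0. A factor pᵏ stays in front
-- of the recurrence: the upper end of the telescoped sum takes its limiting value only modulo the
-- annihilator of pᵏ, and for large k this factor is 0, which starts the uniqueness argument. The
-- obstacle is division: 1 - z is no unit, and 1 - pᵐ is none in a general ring. So (z;p)_∞(z⁻¹;p)_∞
-- is factored as uₙ times a denominator instead of being divided by, and every 1/(p;p)ₘ comes from
-- one inverse, that of (p;p)_∞.

-- The exponents of the double sum

triangular : ℕ → ℕ
triangular zero    = 0
triangular (suc m) = suc m ℕ.+ triangular m

m≤triangular : ∀ m → m ≤ triangular m
m≤triangular zero    = z≤n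
m≤triangular (suc m) = ℕ.m≤m+n (suc m) (triangular m)

2*triangular : ∀ m → 2 ℕ.* triangular m ≡ m ℕ.* m ℕ.+ m
2*triangular zero    = ≡.refl
2*triangular (suc m) = ≡.trans (ℕ.*-distribˡ-+ 2 (suc m) (triangular m))
  (≡.trans (≡.cong (λ t → 2 ℕ.* suc m ℕ.+ t) (2*triangular m)) (rearrange m))
  where
  rearrange : ∀ m → 2 ℕ.* suc m ℕ.+ (m ℕ.* m ℕ.+ m) ≡ suc m ℕ.* suc m ℕ.+ suc m
  rearrange = ℕ-solve-∀

-- With k = n - m the exponent separates: k² + k goes with the coefficient of zᵏ + z⁻ᵏ - 2, and the
-- rest is the exponent in the m-th term of the partial theta function fₖ.
exponent-+ : ∀ k m →
  exponent (k ℕ.+ m) m ≡ k ℕ.* k ℕ.+ k ℕ.+ (triangular m ℕ.+ m ℕ.* (k ℕ.+ k))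
exponent-+ k m = begin
  ((2 ℕ.* (k ℕ.+ m) ℕ.^ 2 ∸ m ℕ.^ 2) ℕ.+ (2 ℕ.* (k ℕ.+ m) ∸ m)) ℕ./ 2
    ≡⟨ ≡.cong₂ (λ a b → (a ℕ.+ b) ℕ./ 2)
         (≡.trans (≡.cong (_∸ m ℕ.^ 2) (squares k m)) (ℕ.m+n∸n≡m _ (m ℕ.^ 2)))
         (≡.trans (≡.cong (_∸ m) (linear k m)) (ℕ.m+n∸n≡m _ m)) ⟩
  ((m ℕ.* m ℕ.+ 4 ℕ.* (k ℕ.* m) ℕ.+ 2 ℕ.* (k ℕ.* k)) ℕ.+ (2 ℕ.* k ℕ.+ m)) ℕ./ 2
    ≡⟨ ≡.cong (ℕ._/ 2) (≡.trans (collect k m (m ℕ.* m)) (≡.trans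
         (≡.cong (λ t → t ℕ.+ 2 ℕ.* (k ℕ.* k ℕ.+ k ℕ.+ m ℕ.* (k ℕ.+ k))) (≡.sym (2*triangular m)))
         (double k m (triangular m)))) ⟩
  ((k ℕ.* k ℕ.+ k ℕ.+ (triangular m ℕ.+ m ℕ.* (k ℕ.+ k))) ℕ.* 2) ℕ./ 2
    ≡⟨ m*n/n≡m (k ℕ.* k ℕ.+ k ℕ.+ (triangular m ℕ.+ m ℕ.* (k ℕ.+ k))) 2 ⟩
  k ℕ.* k ℕ.+ k ℕ.+ (triangular m ℕ.+ m ℕ.* (k ℕ.+ k)) ∎
  where
  open ≡.≡-Reasoning
  squares : ∀ k m → 2 ℕ.* ((k ℕ.+ m) ℕ.* ((k ℕ.+ m) ℕ.* 1)) ≡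
    (m ℕ.* m ℕ.+ 4 ℕ.* (k ℕ.* m) ℕ.+ 2 ℕ.* (k ℕ.* k)) ℕ.+ m ℕ.* (m ℕ.* 1)
  squares = ℕ-solve-∀
  linear : ∀ k m → 2 ℕ.* (k ℕ.+ m) ≡ (2 ℕ.* k ℕ.+ m) ℕ.+ m
  linear = ℕ-solve-∀
  collect : ∀ k m s → (s ℕ.+ 4 ℕ.* (k ℕ.* m) ℕ.+ 2 ℕ.* (k ℕ.* k)) ℕ.+ (2 ℕ.* k ℕ.+ m) ≡
    (s ℕ.+ m) ℕ.+ 2 ℕ.* (k ℕ.* k ℕ.+ k ℕ.+ m ℕ.* (k ℕ.+ k))
  collect = ℕ-solve-∀
  double : ∀ k m t → 2 ℕ.* t ℕ.+ 2 ℕ.* (k ℕ.* k ℕ.+ k ℕ.+ m ℕ.* (k ℕ.+ k)) ≡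
    (k ℕ.* k ℕ.+ k ℕ.+ (t ℕ.+ m ℕ.* (k ℕ.+ k))) ℕ.* 2
  double = ℕ-solve-∀

-- This gives the q-adic convergence of the double sum: its n-th inner sum is divisible by qⁿ.
n≤exponent : ∀ n m → m ≤ n → n ≤ exponent n m
n≤exponent n m m≤n = ≡.subst (λ n → n ≤ exponent n m) (ℕ.m∸n+n≡m m≤n)
  (≡.subst (k ℕ.+ m ≤_) (≡.sym (exponent-+ k m))
    (ℕ.+-mono-≤ (ℕ.m≤n+m k (k ℕ.* k)) (ℕ.≤-trans (m≤triangular m) (ℕ.m≤m+n (triangular m) _))))
  where k = n ∸ m

-- A ring solver with integer coefficients for any commutative ring

module IntegerSolver {c ℓ} (R : CommutativeRing c ℓ) where
  open CommutativeRing R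
  open Algebra.Properties.Ring ring using (-‿distribˡ-*; -‿distribʳ-*)
  open Algebra.Properties.AbelianGroup +-abelianGroup
    using (⁻¹-∙-comm; ε⁻¹≈ε; ⁻¹-involutive)
  open Algebra.Properties.Semiring.Mult.TCOptimised semiring
    using (×1-homo-*; ×-homo-+; 1+×) renaming (_×_ to _×′_)
  open Relation.Binary.Reasoning.Setoid setoid

  private
    ⟦_⟧ : ℤ → Carrier
    ⟦ + n ⟧      = n ×′ 1#
    ⟦ -[1+ n ] ⟧ = - (suc n ×′ 1#)

    ⊖-homo : ∀ m n → ⟦ m ℤ.⊖ n ⟧ ≈ m ×′ 1# - n ×′ 1#
    ⊖-homo m       zero    = sym (trans (+-congˡ ε⁻¹≈ε) (+-identityʳ _))
    ⊖-homo zero    (suc n) = sym (+-identityˡ _)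
    ⊖-homo (suc m) (suc n) = begin
      ⟦ suc m ℤ.⊖ suc n ⟧                ≡⟨ ≡.cong ⟦_⟧ (ℤ.[1+m]⊖[1+n]≡m⊖n m n) ⟩
      ⟦ m ℤ.⊖ n ⟧                        ≈⟨ ⊖-homo m n ⟩
      a - b                              ≈⟨ +-congʳ (+-identityˡ a) ⟨
      0# + a - b                         ≈⟨ +-congʳ (+-congʳ (-‿inverseʳ 1#)) ⟨
      1# - 1# + a - b                    ≈⟨ +-congʳ (+-assoc _ _ _) ⟩
      1# + (- 1# + a) - b                ≈⟨ +-congʳ (+-congˡ (+-comm _ _)) ⟩
      1# + (a - 1#) - b                  ≈⟨ +-congʳ (+-assoc _ _ _) ⟨
      1# + a - 1# - b                    ≈⟨ +-assoc _ _ _ ⟩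
      1# + a + (- 1# - b)                ≈⟨ +-congˡ (⁻¹-∙-comm 1# b) ⟩
      1# + a - (1# + b)                  ≈⟨ +-cong (1+× m 1#) (-‿cong (1+× n 1#)) ⟨
      suc m ×′ 1# - suc n ×′ 1#          ∎
      where a = m ×′ 1#
            b = n ×′ 1#

    +-homo : ∀ i j → ⟦ i ℤ.+ j ⟧ ≈ ⟦ i ⟧ + ⟦ j ⟧
    +-homo (+ m)    (+ n)    = ×-homo-+ 1# m n
    +-homo (+ m)    -[1+ n ] = ⊖-homo m (suc n)
    +-homo -[1+ m ] (+ n)    = trans (⊖-homo n (suc m)) (+-comm _ _)
    +-homo -[1+ m ] -[1+ n ] = begin
      - (suc (suc (m ℕ.+ n)) ×′ 1#)         ≡⟨ ≡.cong (λ k → - (suc k ×′ 1#)) (ℕ.+-suc m n) ⟨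
      - ((suc m ℕ.+ suc n) ×′ 1#)           ≈⟨ -‿cong (×-homo-+ 1# (suc m) (suc n)) ⟩
      - (suc m ×′ 1# + suc n ×′ 1#)         ≈⟨ ⁻¹-∙-comm _ _ ⟨
      - (suc m ×′ 1#) + - (suc n ×′ 1#)     ∎

    neg-homo : ∀ i → ⟦ ℤ.- i ⟧ ≈ - ⟦ i ⟧
    neg-homo (+ zero)  = sym ε⁻¹≈ε
    neg-homo (+ suc n) = refl
    neg-homo -[1+ n ]  = sym (⁻¹-involutive _)

    *-homo⁺ : ∀ m n → ⟦ + m ℤ.* + n ⟧ ≈ ⟦ + m ⟧ * ⟦ + n ⟧
    *-homo⁺ m n = begin
      ⟦ + m ℤ.* + n ⟧   ≡⟨ ≡.cong ⟦_⟧ (ℤ.pos-* m n) ⟨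
      (m ℕ.* n) ×′ 1#   ≈⟨ ×1-homo-* m n ⟩
      m ×′ 1# * n ×′ 1# ∎

    *-homo⁻ : ∀ m j → ⟦ + m ℤ.* j ⟧ ≈ ⟦ + m ⟧ * ⟦ j ⟧
    *-homo⁻ m (+ n)    = *-homo⁺ m n
    *-homo⁻ m -[1+ n ] = begin
      ⟦ + m ℤ.* -[1+ n ] ⟧      ≡⟨ ≡.cong ⟦_⟧ (ℤ.neg-distribʳ-* (+ m) (+ suc n)) ⟨
      ⟦ ℤ.- (+ m ℤ.* + suc n) ⟧ ≈⟨ neg-homo (+ m ℤ.* + suc n) ⟩
      - ⟦ + m ℤ.* + suc n ⟧     ≈⟨ -‿cong (*-homo⁺ m (suc n)) ⟩
      - (⟦ + m ⟧ * ⟦ + suc n ⟧) ≈⟨ -‿distribʳ-* _ _ ⟩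
      ⟦ + m ⟧ * ⟦ -[1+ n ] ⟧    ∎

    *-homo : ∀ i j → ⟦ i ℤ.* j ⟧ ≈ ⟦ i ⟧ * ⟦ j ⟧
    *-homo (+ m)    j = *-homo⁻ m j
    *-homo -[1+ m ] j = begin
      ⟦ -[1+ m ] ℤ.* j ⟧      ≡⟨ ≡.cong ⟦_⟧ (ℤ.neg-distribˡ-* (+ suc m) j) ⟨
      ⟦ ℤ.- (+ suc m ℤ.* j) ⟧ ≈⟨ neg-homo (+ suc m ℤ.* j) ⟩
      - ⟦ + suc m ℤ.* j ⟧     ≈⟨ -‿cong (*-homo⁻ (suc m) j) ⟩
      - (⟦ + suc m ⟧ * ⟦ j ⟧) ≈⟨ -‿distribˡ-* _ _ ⟩
      ⟦ -[1+ m ] ⟧ * ⟦ j ⟧    ∎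

    morphism : ℤ.+-*-rawRing -Raw-AlmostCommutative⟶ fromCommutativeRing R
    morphism = record
      { ⟦_⟧    = ⟦_⟧
      ; +-homo = +-homo
      ; *-homo = *-homo
      ; -‿homo = neg-homo
      ; 0-homo = refl
      ; 1-homo = refl
      }

    -- Coefficients are compared in ℤ, since equality in `R` need not be decidable. Different
    -- integers may agree in `R`, hence `nothing` and not a refutation.
    _≟′_ : WeaklyDecidable (λ i j → ⟦ i ⟧ ≈ ⟦ j ⟧)
    i ≟′ j with i ℤ.≟ j
    ... | yes i≡j = just (reflexive (≡.cong ⟦_⟧ i≡j))
    ... | no  _   = nothing

  open Algebra.Solver.Ring ℤ.+-*-rawRing (fromCommutativeRing R) morphism _≟′_ public
    using (solve; con; _:=_; _:+_; _:*_; _:-_; :-_; Polynomial)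

  𝟘 𝟙 𝟚 : ∀ {n} → Polynomial n
  𝟘 = con 0ℤ
  𝟙 = con 1ℤ
  𝟚 = con (+ 2)

-- Finite sums and products

module FiniteSums {c ℓ} (R : CommutativeRing c ℓ) where
  open CommutativeRing R
  open Algebra.Definitions.RawSemiring (Semiring.rawSemiring semiring) using (sum; product)
  open IntegerSolver R
  open Relation.Binary.Reasoning.Setoid setoid

  ∑< ∏< : ℕ → (ℕ → Carrier) → Carrier
  ∑< zero    f = 0#
  ∑< (suc n) f = f 0 + ∑< n (f ∘ suc)
  ∏< zero    f = 1#
  ∏< (suc n) f = f 0 * ∏< n (f ∘ suc)

  sum-∑< : ∀ n f → sum {n} (f ∘ toℕ) ≡ ∑< n f
  sum-∑< zero    f = ≡.refl
  sum-∑< (suc n) f = ≡.cong (λ x → f 0 + x) (sum-∑< n (f ∘ suc))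

  product-∏< : ∀ n f → product {n} (f ∘ toℕ) ≡ ∏< n f
  product-∏< zero    f = ≡.refl
  product-∏< (suc n) f = ≡.cong (λ x → f 0 * x) (product-∏< n (f ∘ suc))

  ∑<-cong : ∀ n {f g} → (∀ i → i < n → f i ≈ g i) → ∑< n f ≈ ∑< n g
  ∑<-cong zero    f≈g = refl
  ∑<-cong (suc n) f≈g =
    +-cong (f≈g 0 ℕ.z<s) (∑<-cong n (λ i i<n → f≈g (suc i) (s<s i<n)))

  ∏<-cong : ∀ n {f g} → (∀ i → i < n → f i ≈ g i) → ∏< n f ≈ ∏< n g
  ∏<-cong zero    f≈g = refl
  ∏<-cong (suc n) f≈g =
    *-cong (f≈g 0 ℕ.z<s) (∏<-cong n (λ i i<n → f≈g (suc i) (s<s i<n)))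

  ∑<-zero : ∀ n {f} → (∀ i → i < n → f i ≈ 0#) → ∑< n f ≈ 0#
  ∑<-zero zero    f≈0 = refl
  ∑<-zero (suc n) f≈0 = trans
    (+-cong (f≈0 0 ℕ.z<s) (∑<-zero n (λ i i<n → f≈0 (suc i) (s<s i<n))))
    (+-identityˡ 0#)

  ∑<-last : ∀ n f → ∑< (suc n) f ≈ ∑< n f + f n
  ∑<-last zero    f = +-comm _ _
  ∑<-last (suc n) f = trans (+-congˡ (∑<-last n (f ∘ suc))) (sym (+-assoc _ _ _))

  ∏<-last : ∀ n f → ∏< (suc n) f ≈ ∏< n f * f n
  ∏<-last zero    f = *-comm _ _
  ∏<-last (suc n) f = trans (*-congˡ (∏<-last n (f ∘ suc))) (sym (*-assoc _ _ _))

  *-distribˡ-∑< : ∀ n a f → a * ∑< n f ≈ ∑< n (λ i → a * f i)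
  *-distribˡ-∑< zero    a f = zeroʳ a
  *-distribˡ-∑< (suc n) a f =
    trans (distribˡ _ _ _) (+-congˡ (*-distribˡ-∑< n a (f ∘ suc)))

  ∑<-+ : ∀ n f g → ∑< n (λ i → f i + g i) ≈ ∑< n f + ∑< n g
  ∑<-+ zero    f g = sym (+-identityˡ 0#)
  ∑<-+ (suc n) f g = trans (+-congˡ (∑<-+ n (f ∘ suc) (g ∘ suc)))
    (solve 4 (λ a b c d → (a :+ b) :+ (c :+ d) := (a :+ c) :+ (b :+ d)) refl _ _ _ _)

  ∑<-comm : ∀ m n (f : ℕ → ℕ → Carrier) →
            ∑< m (λ i → ∑< n (f i)) ≈ ∑< n (λ j → ∑< m (λ i → f i j))
  ∑<-comm zero    n f = sym (∑<-zero n (λ _ _ → refl))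
  ∑<-comm (suc m) n f = trans (+-congˡ (∑<-comm m n (f ∘ suc))) (sym (∑<-+ n _ _))

  ∑<-telescope : ∀ n (h : ℕ → Carrier) → ∑< n (λ i → h (suc i) - h i) ≈ h n - h 0
  ∑<-telescope zero    h = sym (-‿inverseʳ _)
  ∑<-telescope (suc n) h = trans (+-congˡ (∑<-telescope n (h ∘ suc)))
    (solve 3 (λ a b c → (a :- b) :+ (c :- a) := c :- b) refl _ _ _)

  ∑<-extend : ∀ m n f → (∀ i → n ≤ i → f i ≈ 0#) → ∑< (n ℕ.+ m) f ≈ ∑< n f
  ∑<-extend m zero    f f≈0 = ∑<-zero m (λ i _ → f≈0 i z≤n)
  ∑<-extend m (suc n) f f≈0 =
    +-congˡ (∑<-extend m n (f ∘ suc) (λ i n≤i → f≈0 (suc i) (s≤s n≤i)))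

  -- Induction on n strips the column m = 0 and shifts m by one. The triangle then loses a row while
  -- the range of k has to stay the same, so the slack d grows as n shrinks.
  ∑<-triangle : ∀ n d (f : ℕ → ℕ → Carrier) →
                (∀ k m → n ≤ k ℕ.+ m → f k m ≈ 0#) →
                ∑< n (λ j → ∑< (suc j) (λ m → f (j ∸ m) m)) ≈
                ∑< (n ℕ.+ d) (λ k → ∑< n (f k))
  ∑<-triangle zero    d f f≈0 = sym (∑<-zero d (λ _ _ → refl))
  ∑<-triangle (suc n) d f f≈0 = begin
    ∑< (suc n) (λ j → f j 0 + ∑< j (λ m → f (j ∸ suc m) (suc m)))
      ≈⟨ ∑<-+ (suc n) (λ j → f j 0) (λ j → ∑< j (λ m → f (j ∸ suc m) (suc m))) ⟩
    ∑< (suc n) (λ j → f j 0) + (0# + ∑< n (λ j → ∑< (suc j) (λ m → f (j ∸ m) (suc m))))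
      ≈⟨ +-cong
           (sym (∑<-extend d (suc n) (λ j → f j 0)
             (λ k n<k → f≈0 k 0 (≡.subst (suc n ≤_) (≡.sym (ℕ.+-identityʳ k)) n<k))))
           (trans (+-identityˡ _) (∑<-triangle n (suc d) (λ k → f k ∘ suc)
             (λ k m n≤k+m → f≈0 k (suc m) (≡.subst (suc n ≤_) (≡.sym (ℕ.+-suc k m)) (s≤s n≤k+m))))) ⟩
    ∑< (suc n ℕ.+ d) (λ k → f k 0) + ∑< (n ℕ.+ suc d) (λ k → ∑< n (f k ∘ suc))
      ≡⟨ ≡.cong (λ w → ∑< (suc n ℕ.+ d) (λ k → f k 0) + ∑< w (λ k → ∑< n (f k ∘ suc))) (ℕ.+-suc n d) ⟩
    ∑< (suc n ℕ.+ d) (λ k → f k 0) + ∑< (suc n ℕ.+ d) (λ k → ∑< n (f k ∘ suc))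
      ≈⟨ ∑<-+ (suc n ℕ.+ d) (λ k → f k 0) (λ k → ∑< n (f k ∘ suc)) ⟨
    ∑< (suc n ℕ.+ d) (λ k → ∑< (suc n) (f k)) ∎

-- Expansion of (z;p)ₙ(z⁻¹;p)ₙ in the Laurent polynomials zᵏ + z⁻ᵏ

module Expansion {c ℓ} (R : CommutativeRing c ℓ) (p : CommutativeRing.Carrier R) where
  open CommutativeRing R
  open Algebra.Properties.Semiring.Exp semiring using (_^_; ^-homo-*)
  open IntegerSolver R
  open FiniteSums R
  open Relation.Binary.Reasoning.Setoid setoid

  -- (-1)ᵏ p^(k(k-1)/2)
  s : ℕ → Carrier
  s zero    = 1#
  s (suc k) = - (s k * p ^ k)

  -- For n = ν + 1 this is (1 - pⁿ)(p;p)₂ₙ₋₁, the factor of the coefficients that is free of k. It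
  -- is given by its ratio, in which 1 - pⁿ has already been cancelled against 1 - p²ⁿ, so that the
  -- recurrences in ν need no division.
  ρ : ℕ → Carrier
  ρ zero    = (1# - p) * (1# - p)
  ρ (suc ν) = (1# - p * X) * (1# + X) * (1# - p * (X * X)) * ρ ν
    where X = p ^ suc ν

  p⨾p : ℕ → Carrier
  p⨾p zero    = 1#
  p⨾p (suc m) = p⨾p m * (1# - p ^ suc m)

  ρ-closed : ∀ ν → ρ ν ≈ (1# - p ^ suc ν) * p⨾p (suc (ν ℕ.+ ν))
  ρ-closed zero    =
    solve 1 (λ p → (𝟙 :- p) :* (𝟙 :- p) := (𝟙 :- p :* 𝟙) :* (𝟙 :* (𝟙 :- p :* 𝟙))) refl p
  ρ-closed (suc ν) = begin
    (1# - p * X) * (1# + X) * (1# - p * (X * X)) * ρ ν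
      ≈⟨ *-congˡ (ρ-closed ν) ⟩
    (1# - p * X) * (1# + X) * (1# - p * (X * X)) * ((1# - X) * w)
      ≈⟨ solve 3 (λ p X w →
           (𝟙 :- p :* X) :* (𝟙 :+ X) :* (𝟙 :- p :* (X :* X)) :* ((𝟙 :- X) :* w)
           := (𝟙 :- p :* X) :* (w :* (𝟙 :- X :* X) :* (𝟙 :- p :* (X :* X)))) refl p X w ⟩
    (1# - p * X) * (w * (1# - X * X) * (1# - p * (X * X)))
      ≈⟨ *-congˡ (*-cong (*-congˡ (+-congˡ (-‿cong XX)))
                         (+-congˡ (-‿cong (*-congˡ XX)))) ⟩
    (1# - p * X) * (w * (1# - p ^ suc (suc (ν ℕ.+ ν))) * (1# - p ^ suc (suc (suc (ν ℕ.+ ν)))))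
      ≡⟨ ≡.cong (λ m → (1# - p * X) * p⨾p (suc (suc m))) (ℕ.+-suc ν ν) ⟨
    (1# - p * X) * p⨾p (suc (suc ν ℕ.+ suc ν)) ∎
    where
    X = p ^ suc ν
    w = p⨾p (suc (ν ℕ.+ ν))
    XX : X * X ≈ p ^ suc (suc (ν ℕ.+ ν))
    XX = trans (sym (^-homo-* p (suc ν) (suc ν)))
               (reflexive (≡.cong (λ m → p ^ suc m) (ℕ.+-suc ν ν)))

  -- `i m` plays 1/(p;p)ₘ. It is specified by equations because 1 - pᵐ need not be invertible in
  -- `R`.
  module Inverse (i : ℕ → Carrier) (i-zero : i 0 ≈ 1#)
                 (i-suc : ∀ m → i m ≈ (1# - p ^ suc m) * i (suc m)) where

    p⨾p-inverse : ∀ m → p⨾p m * i m ≈ 1#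
    p⨾p-inverse zero    = trans (*-identityˡ _) i-zero
    p⨾p-inverse (suc m) = begin
      p⨾p m * (1# - p ^ suc m) * i (suc m)   ≈⟨ *-assoc _ _ _ ⟩
      p⨾p m * ((1# - p ^ suc m) * i (suc m)) ≈⟨ *-congˡ (i-suc m) ⟨
      p⨾p m * i m                            ≈⟨ p⨾p-inverse m ⟩
      1#                                     ∎

    -- 1/(p;p)ₙ₋ₖ, which is 0 for n < k.
    J : ℕ → ℕ → Carrier
    J n       zero    = i n
    J zero    (suc k) = 0#
    J (suc n) (suc k) = J n k

    J-+ : ∀ k d → J (k ℕ.+ d) k ≡ i d
    J-+ zero    d = ≡.refl
    J-+ (suc k) d = J-+ k d

    -- The factor 1 - p^d is 0 for d = 0, so a single formula also covers the first vanishing entry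
    -- of `J`.
    J-+-suc : ∀ k d → J (k ℕ.+ d) (suc k) ≈ (1# - p ^ d) * i d
    J-+-suc zero    zero    = sym (trans (*-congʳ (-‿inverseʳ 1#)) (zeroˡ _))
    J-+-suc zero    (suc d) = i-suc d
    J-+-suc (suc k) d       = J-+-suc k d

    J-< : ∀ {n k} → n < k → J n k ≡ 0#
    J-< {zero}  (s≤s n≤k) = ≡.refl
    J-< {suc n} (s≤s n<k) = J-< n<k

    p^n*J : ∀ n k → p ^ n * J n k ≈ p ^ k * (p ^ (n ∸ k) * J n k)
    p^n*J n       zero    = sym (*-identityˡ _)
    p^n*J zero    (suc k) = trans (zeroʳ _) (sym (trans (*-congˡ (zeroʳ _)) (zeroʳ _)))
    p^n*J (suc n) (suc k) = begin
      p * p ^ n * J n k                     ≈⟨ *-assoc _ _ _ ⟩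
      p * (p ^ n * J n k)                   ≈⟨ *-congˡ (p^n*J n k) ⟩
      p * (p ^ k * (p ^ (n ∸ k) * J n k))   ≈⟨ *-assoc _ _ _ ⟨
      p * p ^ k * (p ^ (n ∸ k) * J n k)     ∎

    -- For k ≥ n the truncated exponents no longer differ by one, but there `J n (suc k)` is 0.
    p*p^[n∸1+k]*J : ∀ n k → p * (p ^ (n ∸ suc k) * J n (suc k)) ≈ p ^ (n ∸ k) * J n (suc k)
    p*p^[n∸1+k]*J zero    k       = trans (*-congˡ (zeroʳ _)) (trans (zeroʳ _) (sym (zeroʳ _)))
    p*p^[n∸1+k]*J (suc n) zero    = sym (*-assoc _ _ _)
    p*p^[n∸1+k]*J (suc n) (suc k) = p*p^[n∸1+k]*J n k

    -- The coefficient of zᵏ and of z⁻ᵏ in (z;p)ₙ(z⁻¹;p)ₙ for n = ν + 1.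
    γ : ℕ → ℕ → Carrier
    γ ν k = s k * (1# + p ^ k) * (J (suc ν) k * i (k ℕ.+ suc ν)) * ρ ν

    γ-J≈0 : ∀ ν k → J (suc ν) k ≈ 0# → γ ν k ≈ 0#
    γ-J≈0 ν k J≈0 = trans
      (*-congʳ (trans (*-congˡ (trans (*-congʳ J≈0) (zeroˡ _))) (zeroʳ _))) (zeroˡ _)

    γ-< : ∀ {ν k} → suc ν < k → γ ν k ≈ 0#
    γ-< {ν} {k} n<k = γ-J≈0 ν k (reflexive (J-< n<k))

    -- The next factor of the product is (1 - zX)(1 - z⁻¹X) = 1 + X² - X(z + z⁻¹). In the constant
    -- coefficient both z¹ and z⁻¹ contribute `γ ν 1`.
    γ-suc-zero : ∀ ν → let X = p ^ suc ν in
                 γ (suc ν) 0 ≈ (1# + X * X) * γ ν 0 - X * (γ ν 1 + γ ν 1)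
    γ-suc-zero ν = begin
      1# * (1# + 1#) * (i₂ * i₂) * ((1# - p * X) * (1# + X) * (1# - p * (X * X)) * ρ ν)
        ≈⟨ solve 4 (λ p X b r →
             𝟙 :* 𝟚 :* (b :* b) :* ((𝟙 :- p :* X) :* (𝟙 :+ X) :* (𝟙 :- p :* (X :* X)) :* r)
             := let a = (𝟙 :- p :* X) :* b
                    j = (𝟙 :- X) :* a
                    c₁ = :- (𝟙 :* 𝟙) :* (𝟙 :+ p :* 𝟙) :* (j :* b) :* r
                in (𝟙 :+ X :* X) :* (𝟙 :* 𝟚 :* (a :* a) :* r) :- X :* (c₁ :+ c₁))
             refl p X i₂ (ρ ν) ⟩
      (1# + X * X) * (1# * (1# + 1#) * (a * a) * ρ ν) - X * (c₁ + c₁)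
        ≈⟨ +-cong (*-congˡ (*-congʳ (*-congˡ (*-cong a≈ a≈))))
                  (-‿cong (*-congˡ (+-cong c₁≈ c₁≈))) ⟩
      (1# + X * X) * γ ν 0 - X * (γ ν 1 + γ ν 1) ∎
      where
      X  = p ^ suc ν
      i₂ = i (suc (suc ν))
      a  = (1# - p * X) * i₂
      a≈ = sym (i-suc (suc ν))
      c₁ = - (1# * 1#) * (1# + p * 1#) * ((1# - X) * a * i₂) * ρ ν
      c₁≈ : c₁ ≈ γ ν 1
      c₁≈ = *-congʳ (*-congˡ (*-congʳ (trans (*-congˡ a≈) (sym (i-suc ν)))))

    private
      1-cong : ∀ {x y} → x ≈ y → 1# - x ≈ 1# - y
      1-cong x≈y = +-congˡ (-‿cong x≈y)

      p^[κ+n] : ∀ κ n {m} → p ^ n ≈ m → p ^ (κ ℕ.+ n) ≈ p ^ κ * m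
      p^[κ+n] κ n p^n≈m = trans (^-homo-* p κ n) (*-congˡ p^n≈m)

    -- Each inverse that occurs is a polynomial multiple of one of the two of largest index, `a` and
    -- `b`. Once all are written this way, a polynomial identity in p, p^κ and p^d remains.
    γ-suc-suc-≤ : ∀ κ d → let ν = κ ℕ.+ d ; X = p ^ suc ν in
      γ (suc ν) (suc κ) ≈ (1# + X * X) * γ ν (suc κ) - X * (γ ν κ + γ ν (suc (suc κ)))
    γ-suc-suc-≤ κ d = begin
      - (S * K) * (1# + p * K) * (J (suc ν) κ * i (suc κ ℕ.+ suc (suc ν)))
        * ((1# - p * X) * (1# + X) * (1# - p * (X * X)) * r)
        ≈⟨ *-cong (*-congˡ (*-cong J₀≈ b≈))
             (*-congʳ (*-cong (*-cong (1-cong (*-congˡ X≈)) (+-congˡ X≈))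
                              (1-cong (*-congˡ (*-cong X≈ X≈))))) ⟩
      - (S * K) * (1# + p * K) * (a * b)
        * ((1# - p * Y) * (1# + Y) * (1# - p * (Y * Y)) * r)
        ≈⟨ solve 7 (λ p S K D a b r →
             let Y  = p :* (K :* D)
                 a₁ = (𝟙 :- p :* D) :* a
                 b₁ = (𝟙 :- p :* (p :* (K :* Y))) :* b
             in
             :- (S :* K) :* (𝟙 :+ p :* K) :* (a :* b)
               :* ((𝟙 :- p :* Y) :* (𝟙 :+ Y) :* (𝟙 :- p :* (Y :* Y)) :* r)
             := (𝟙 :+ Y :* Y) :* (:- (S :* K) :* (𝟙 :+ p :* K) :* (a₁ :* b₁) :* r)
                :- Y :* (S :* (𝟙 :+ K) :* (a :* ((𝟙 :- p :* (K :* Y)) :* b₁)) :* r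
                         :+ :- (:- (S :* K) :* (p :* K)) :* (𝟙 :+ p :* (p :* K))
                            :* ((𝟙 :- D) :* a₁ :* b) :* r))
             refl p S K D a b r ⟩
      (1# + Y * Y) * (- (S * K) * (1# + p * K) * (a₁ * b₁) * r)
        - Y * (S * (1# + K) * (a * ((1# - p * (K * Y)) * b₁)) * r
               + - (- (S * K) * (p * K)) * (1# + p * (p * K)) * ((1# - D) * a₁ * b) * r)
        ≈⟨ +-cong (*-cong (+-congˡ (*-cong X≈ X≈)) (*-congʳ (*-congˡ (*-cong J₁≈ b₁≈))))
             (-‿cong (*-cong X≈ (+-cong
               (*-congʳ (*-congˡ (*-cong J₀≈ b₀≈)))
               (*-congʳ (*-congˡ (*-congʳ J₂≈)))))) ⟨
      (1# + X * X) * γ ν (suc κ) - X * (γ ν κ + γ ν (suc (suc κ))) ∎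
      where
      ν = κ ℕ.+ d
      X = p ^ suc ν
      K = p ^ κ
      D = p ^ d
      Y = p * (K * D)
      S = s κ
      r = ρ ν
      a = i (suc d)
      m = κ ℕ.+ suc ν
      b = i (suc (suc m))
      a₁ = (1# - p * D) * a
      b₁ = (1# - p * (p * (K * Y))) * b
      X≈ : X ≈ Y
      X≈ = *-congˡ (^-homo-* p κ d)
      b≈ : i (suc κ ℕ.+ suc (suc ν)) ≈ b
      b≈ = reflexive (≡.cong (λ m → i (suc m)) (ℕ.+-suc κ (suc ν)))
      p^m≈ : p ^ m ≈ K * Y
      p^m≈ = p^[κ+n] κ (suc ν) X≈
      b₁≈ : i (suc m) ≈ b₁
      b₁≈ = trans (i-suc (suc m)) (*-congʳ (1-cong (*-congˡ (*-congˡ p^m≈))))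
      b₀≈ : i m ≈ (1# - p * (K * Y)) * b₁
      b₀≈ = trans (i-suc m) (*-cong (1-cong (*-congˡ p^m≈)) b₁≈)
      J₀≈ : J (suc ν) κ ≈ a
      J₀≈ = reflexive (≡.trans (≡.cong (λ n → J n κ) (≡.sym (ℕ.+-suc κ d))) (J-+ κ (suc d)))
      J₁≈ : J ν κ ≈ a₁
      J₁≈ = trans (reflexive (J-+ κ d)) (i-suc d)
      J₂≈ : J ν (suc κ) ≈ (1# - D) * a₁
      J₂≈ = trans (J-+-suc κ d) (*-congˡ (i-suc d))

    -- This is the new top coefficient, which only the old top coefficient feeds: the other two old
    -- ones lie beyond the degree.
    γ-suc-suc-≡ : ∀ ν → let X = p ^ suc ν in
      γ (suc ν) (suc (suc ν)) ≈
      (1# + X * X) * γ ν (suc (suc ν)) - X * (γ ν (suc ν) + γ ν (suc (suc (suc ν))))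
    γ-suc-suc-≡ ν = begin
      - (S * X) * (1# + p * X) * (a * i (suc (suc ν) ℕ.+ suc (suc ν)))
        * ((1# - p * X) * (1# + X) * (1# - p * (X * X)) * r)
        ≈⟨ *-congʳ (*-congˡ (*-congˡ b≈)) ⟩
      - (S * X) * (1# + p * X) * (a * b)
        * ((1# - p * X) * (1# + X) * (1# - p * (X * X)) * r)
        ≈⟨ solve 6 (λ p S X a b r →
             :- (S :* X) :* (𝟙 :+ p :* X) :* (a :* b)
               :* ((𝟙 :- p :* X) :* (𝟙 :+ X) :* (𝟙 :- p :* (X :* X)) :* r)
             := (𝟙 :+ X :* X) :* 𝟘
                :- X :* (S :* (𝟙 :+ X) :* (a :* ((𝟙 :- p :* (X :* X)) :*
                           ((𝟙 :- p :* (p :* (X :* X))) :* b))) :* r :+ 𝟘))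
             refl p S X a b r ⟩
      (1# + X * X) * 0#
        - X * (S * (1# + X) * (a * ((1# - p * (X * X)) * ((1# - p * (p * (X * X))) * b))) * r + 0#)
        ≈⟨ +-cong (*-congˡ (γ-< {ν} (ℕ.n<1+n (suc ν))))
             (-‿cong (*-congˡ (+-cong (*-congʳ (*-congˡ (*-congˡ i₀≈)))
                                      (γ-< {ν} (ℕ.m<n⇒m<1+n (ℕ.n<1+n (suc ν))))))) ⟨
      (1# + X * X) * γ ν (suc (suc ν)) - X * (γ ν (suc ν) + γ ν (suc (suc (suc ν)))) ∎
      where
      X = p ^ suc ν
      S = s (suc ν)
      r = ρ ν
      a = J (suc ν) (suc ν)
      m = suc ν ℕ.+ suc ν
      b = i (suc (suc m))
      b≈ : i (suc (suc ν) ℕ.+ suc (suc ν)) ≈ b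
      b≈ = reflexive (≡.cong (λ m → i (suc (suc m))) (ℕ.+-suc ν (suc ν)))
      p^m≈ : p ^ m ≈ X * X
      p^m≈ = ^-homo-* p (suc ν) (suc ν)
      i₀≈ : i m ≈ (1# - p * (X * X)) * ((1# - p * (p * (X * X))) * b)
      i₀≈ = trans (i-suc m) (*-cong (1-cong (*-congˡ p^m≈))
              (trans (i-suc (suc m)) (*-congʳ (1-cong (*-congˡ (*-congˡ p^m≈))))))

    γ-suc-suc : ∀ ν κ → let X = p ^ suc ν in
      γ (suc ν) (suc κ) ≈ (1# + X * X) * γ ν (suc κ) - X * (γ ν κ + γ ν (suc (suc κ)))
    γ-suc-suc ν κ with ℕ.<-cmp κ (suc ν)
    ... | tri< (s≤s κ≤ν) _ _ with ν ∸ κ | ℕ.m+[n∸m]≡n κ≤ν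
    ...   | d | ≡.refl = γ-suc-suc-≤ κ d
    γ-suc-suc ν κ | tri≈ _ ≡.refl _ = γ-suc-suc-≡ ν
    γ-suc-suc ν κ | tri> _ _ n<κ = begin
      γ (suc ν) (suc κ)                  ≈⟨ γ-< {suc ν} (s<s n<κ) ⟩
      0#                                 ≈⟨ solve 1 (λ X → 𝟘 := (𝟙 :+ X :* X) :* 𝟘 :- X :* (𝟘 :+ 𝟘)) refl X ⟩
      (1# + X * X) * 0# - X * (0# + 0#)
        ≈⟨ +-cong (*-congˡ (γ-< {ν} (ℕ.m<n⇒m<1+n n<κ)))
             (-‿cong (*-congˡ (+-cong (γ-< {ν} n<κ) (γ-< {ν} (ℕ.m<n⇒m<1+n (ℕ.m<n⇒m<1+n n<κ)))))) ⟨
      (1# + X * X) * γ ν (suc κ) - X * (γ ν κ + γ ν (suc (suc κ))) ∎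
      where X = p ^ suc ν

    module _ (z z⁻¹ : Carrier) (zz⁻¹≈1 : z * z⁻¹ ≈ 1#) where

      ψ : ℕ → Carrier
      ψ k = z ^ k + z⁻¹ ^ k

      u : ℕ → Carrier
      u n = ∏< n (λ j → (1# - z * p ^ j) * (1# - z⁻¹ * p ^ j))

      ψ-suc-suc : ∀ k → (z + z⁻¹) * ψ (suc k) ≈ ψ (suc (suc k)) + ψ k
      ψ-suc-suc k = begin
        (z + z⁻¹) * (z * x + z⁻¹ * y)
          ≈⟨ solve 4 (λ z w x y → (z :+ w) :* (z :* x :+ w :* y)
               := (z :* (z :* x) :+ w :* (w :* y)) :+ z :* w :* (x :+ y)) refl z z⁻¹ x y ⟩
        ψ (suc (suc k)) + z * z⁻¹ * (x + y)
          ≈⟨ +-congˡ (trans (*-congʳ zz⁻¹≈1) (*-identityˡ _)) ⟩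
        ψ (suc (suc k)) + ψ k ∎
        where x = z ^ k
              y = z⁻¹ ^ k

      -- By `ψ-suc-suc`, multiplication by z + z⁻¹ shifts the index both ways. The constant term
      -- becomes 2 a₁ because `ψ 0` is 2, which is also why a₀ stands outside the sum. The last
      -- bracket is what the cut at K leaves over.
      [z+z⁻¹]*∑ψ : ∀ K (a : ℕ → Carrier) →
        (z + z⁻¹) * (a 0 + ∑< K (λ j → a (suc j) * ψ (suc j))) ≈
        (a 1 + a 1) + ∑< K (λ j → (a j + a (suc (suc j))) * ψ (suc j))
          + (a K * ψ (suc K) - a (suc K) * ψ K)
      [z+z⁻¹]*∑ψ zero    a = solve 4 (λ z w a b →
        (z :+ w) :* (a :+ 𝟘) := (b :+ b) :+ 𝟘 :+ (a :* (z :* 𝟙 :+ w :* 𝟙) :- b :* 𝟚))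
        refl z z⁻¹ (a 0) (a 1)
      [z+z⁻¹]*∑ψ (suc K) a = begin
        e * (a 0 + ∑< (suc K) f)                         ≈⟨ *-congˡ (+-congˡ (∑<-last K f)) ⟩
        e * (a 0 + (∑< K f + a₁ * ψ₁))
          ≈⟨ solve 5 (λ e a₀ F a₁ ψ₁ → e :* (a₀ :+ (F :+ a₁ :* ψ₁))
               := e :* (a₀ :+ F) :+ a₁ :* (e :* ψ₁)) refl e (a 0) (∑< K f) a₁ ψ₁ ⟩
        e * (a 0 + ∑< K f) + a₁ * (e * ψ₁)
          ≈⟨ +-cong ([z+z⁻¹]*∑ψ K a) (*-congˡ (ψ-suc-suc K)) ⟩
        (a 1 + a 1) + ∑< K g + (a K * ψ₁ - a₁ * ψ K) + a₁ * (ψ₂ + ψ K)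
          ≈⟨ solve 8 (λ b G aK ψ₁ a₁ ψK ψ₂ a₂ →
               b :+ G :+ (aK :* ψ₁ :- a₁ :* ψK) :+ a₁ :* (ψ₂ :+ ψK)
               := b :+ (G :+ (aK :+ a₂) :* ψ₁) :+ (a₁ :* ψ₂ :- a₂ :* ψ₁))
               refl (a 1 + a 1) (∑< K g) (a K) ψ₁ a₁ (ψ K) ψ₂ a₂ ⟩
        (a 1 + a 1) + (∑< K g + g K) + (a₁ * ψ₂ - a₂ * ψ₁)
          ≈⟨ +-congʳ (+-congˡ (∑<-last K g)) ⟨
        (a 1 + a 1) + ∑< (suc K) g + (a₁ * ψ₂ - a₂ * ψ₁) ∎
        where
        e = z + z⁻¹
        f = λ j → a (suc j) * ψ (suc j)
        g = λ j → (a j + a (suc (suc j))) * ψ (suc j)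
        a₁ = a (suc K)
        a₂ = a (suc (suc K))
        ψ₁ = ψ (suc K)
        ψ₂ = ψ (suc (suc K))

      u-one : ∀ K → 1 < K → u 1 ≈ γ 0 0 + ∑< K (λ j → γ 0 (suc j) * ψ (suc j))
      u-one (suc zero)    (s≤s ())
      u-one (suc (suc K)) 1<K = begin
        (1# - z * 1#) * (1# - z⁻¹ * 1#) * 1#
          ≈⟨ solve 2 (λ z w → (𝟙 :- z :* 𝟙) :* (𝟙 :- w :* 𝟙) :* 𝟙
               := 𝟙 :+ z :* w :- (z :* 𝟙 :+ w :* 𝟙)) refl z z⁻¹ ⟩
        1# + z * z⁻¹ - ψ 1
          ≈⟨ +-congʳ (+-congˡ zz⁻¹≈1) ⟩
        1# + 1# - ψ 1
          ≈⟨ solve 1 (λ ψ₁ → 𝟚 :- ψ₁ := 𝟚 :* (𝟙 :* 𝟙) :- 𝟙 :* ψ₁) refl (ψ 1) ⟩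
        (1# + 1#) * (1# * 1#) - 1# * ψ 1
          -- The coefficients of `γ 0` contain inverses that cancel against `ρ 0`. To match them, 1
          -- is written as (p;p)₁ `i 1` and as (p;p)₂ `i 2`.
          ≈⟨ +-cong (*-congˡ (*-cong 1≈x 1≈x)) (-‿cong (*-congʳ 1≈y)) ⟩
        (1# + 1#) * (x * x) - y * ψ 1
          ≈⟨ solve 4 (λ p i₁ i₂ ψ₁ →
               𝟚 :* (((𝟙 :- p :* 𝟙) :* i₁) :* ((𝟙 :- p :* 𝟙) :* i₁))
                 :- 𝟙 :* (𝟙 :- p :* 𝟙) :* (𝟙 :- p :* (p :* 𝟙)) :* i₂ :* ψ₁
               := 𝟙 :* 𝟚 :* (i₁ :* i₁) :* ((𝟙 :- p) :* (𝟙 :- p))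
                 :+ (:- (𝟙 :* 𝟙) :* (𝟙 :+ p :* 𝟙) :* (𝟙 :* i₂)
                       :* ((𝟙 :- p) :* (𝟙 :- p)) :* ψ₁ :+ 𝟘))
               refl p i₁ i₂ (ψ 1) ⟩
        γ 0 0 + (- (1# * 1#) * (1# + p * 1#) * (1# * i₂) * ((1# - p) * (1# - p)) * ψ 1 + 0#)
          ≈⟨ +-congˡ (+-cong (*-congʳ (*-congʳ (*-congˡ (*-congʳ (sym i-zero)))))
               (sym (∑<-zero (suc K) {λ j → γ 0 (suc (suc j)) * ψ (suc (suc j))} (λ j _ → trans (*-congʳ (γ-< {0} (s<s ℕ.z<s))) (zeroˡ (ψ (suc (suc j)))))))) ⟩
        γ 0 0 + ∑< (suc (suc K)) (λ j → γ 0 (suc j) * ψ (suc j)) ∎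
        where
        i₁ = i 1
        i₂ = i 2
        x = (1# - p * 1#) * i₁
        y = 1# * (1# - p * 1#) * (1# - p * (p * 1#)) * i₂
        1≈x : 1# ≈ x
        1≈x = trans (sym i-zero) (i-suc 0)
        1≈y : 1# ≈ y
        1≈y = sym (p⨾p-inverse 2)

      -- Any K above the degree will do: the coefficients beyond are 0, and so is the boundary term
      -- of `[z+z⁻¹]*∑ψ`. The freedom allows one range of summation for all ν later.
      u-expansion : ∀ ν K → suc ν < K →
                    u (suc ν) ≈ γ ν 0 + ∑< K (λ j → γ ν (suc j) * ψ (suc j))
      u-expansion zero    K 1<K = u-one K 1<K
      u-expansion (suc ν) K n<K = begin
        u (suc (suc ν))
          ≈⟨ ∏<-last (suc ν) (λ j → (1# - z * p ^ j) * (1# - z⁻¹ * p ^ j)) ⟩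
        u (suc ν) * ((1# - z * X) * (1# - z⁻¹ * X))
          ≈⟨ *-cong (u-expansion ν K (ℕ.<-trans (ℕ.n<1+n _) n<K))
               (solve 3 (λ z w X → (𝟙 :- z :* X) :* (𝟙 :- w :* X)
                 := 𝟙 :+ z :* w :* (X :* X) :- X :* (z :+ w)) refl z z⁻¹ X) ⟩
        (γ ν 0 + ∑< K f) * (1# + z * z⁻¹ * (X * X) - X * (z + z⁻¹))
          ≈⟨ *-congˡ (+-congʳ (+-congˡ (trans (*-congʳ zz⁻¹≈1) (*-identityˡ _)))) ⟩
        (γ ν 0 + ∑< K f) * (1# + X * X - X * (z + z⁻¹))
          ≈⟨ solve 4 (λ e X g F → (g :+ F) :* (𝟙 :+ X :* X :- X :* e)
               := (𝟙 :+ X :* X) :* (g :+ F) :- X :* (e :* (g :+ F)))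
               refl (z + z⁻¹) X (γ ν 0) (∑< K f) ⟩
        (1# + X * X) * (γ ν 0 + ∑< K f) - X * ((z + z⁻¹) * (γ ν 0 + ∑< K f))
          ≈⟨ +-congˡ (-‿cong (*-congˡ (trans ([z+z⁻¹]*∑ψ K (γ ν)) (+-congˡ boundary)))) ⟩
        (1# + X * X) * (γ ν 0 + ∑< K f) - X * ((γ ν 1 + γ ν 1) + ∑< K g + 0#)
          ≈⟨ solve 5 (λ X a F b G → (𝟙 :+ X :* X) :* (a :+ F) :- X :* (b :+ G :+ 𝟘)
               := ((𝟙 :+ X :* X) :* a :- X :* b) :+ ((𝟙 :+ X :* X) :* F :+ :- X :* G))
               refl X (γ ν 0) (∑< K f) (γ ν 1 + γ ν 1) (∑< K g) ⟩
        ((1# + X * X) * γ ν 0 - X * (γ ν 1 + γ ν 1)) + ((1# + X * X) * ∑< K f + - X * ∑< K g)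
          ≈⟨ +-cong (sym (γ-suc-zero ν)) (trans
               (+-cong (*-distribˡ-∑< K (1# + X * X) f) (*-distribˡ-∑< K (- X) g))
               (sym (∑<-+ K (λ j → (1# + X * X) * f j) (λ j → - X * g j)))) ⟩
        γ (suc ν) 0 + ∑< K (λ j → (1# + X * X) * f j + - X * g j)
          ≈⟨ +-congˡ (∑<-cong K (λ j _ → sym (trans (*-congʳ (γ-suc-suc ν j))
               (solve 5 (λ X a b c ψ → ((𝟙 :+ X :* X) :* a :- X :* (b :+ c)) :* ψ
                 := (𝟙 :+ X :* X) :* (a :* ψ) :+ :- X :* ((b :+ c) :* ψ))
                 refl X (γ ν (suc j)) (γ ν j) (γ ν (suc (suc j))) (ψ (suc j)))))) ⟩
        γ (suc ν) 0 + ∑< K (λ j → γ (suc ν) (suc j) * ψ (suc j)) ∎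
        where
        X = p ^ suc ν
        f = λ j → γ ν (suc j) * ψ (suc j)
        g = λ j → (γ ν j + γ ν (suc (suc j))) * ψ (suc j)
        n<K′ = ℕ.<-trans (ℕ.n<1+n (suc ν)) n<K
        boundary : γ ν K * ψ (suc K) - γ ν (suc K) * ψ K ≈ 0#
        boundary = begin
          γ ν K * ψ (suc K) - γ ν (suc K) * ψ K
            ≈⟨ +-cong (*-congʳ (γ-< {ν} n<K′)) (-‿cong (*-congʳ (γ-< {ν} (ℕ.m<n⇒m<1+n n<K′)))) ⟩
          0# * ψ (suc K) - 0# * ψ K
            ≈⟨ solve 2 (λ x y → 𝟘 :* x :- 𝟘 :* y := 𝟘) refl (ψ (suc K)) (ψ K) ⟩
          0# ∎

    J-suc : ∀ {n k} → k ≤ n → J n (suc k) ≈ (1# - p ^ (n ∸ k)) * J n k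
    J-suc {n} {k} k≤n with n ∸ k | ℕ.m+[n∸m]≡n k≤n
    ... | d | ≡.refl = trans (J-+-suc k d) (*-congˡ (reflexive (≡.sym (J-+ k d))))

    1^k≈1 : ∀ k → 1# ^ k ≈ 1#
    1^k≈1 zero    = refl
    1^k≈1 (suc k) = trans (*-identityˡ _) (1^k≈1 k)

    -- Subtracting the expansion at z = 1 removes the constant term.
    u-expansion′ : ∀ z z⁻¹ zz⁻¹≈1 ν K → suc ν < K →
      u z z⁻¹ zz⁻¹≈1 (suc ν) ≈ ∑< K (λ j → γ ν (suc j) * (ψ z z⁻¹ zz⁻¹≈1 (suc j) - (1# + 1#)))
    u-expansion′ z z⁻¹ zz⁻¹≈1 ν K n<K = begin
      u z z⁻¹ zz⁻¹≈1 (suc ν)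
        ≈⟨ u-expansion z z⁻¹ zz⁻¹≈1 ν K n<K ⟩
      γ ν 0 + ∑< K f
        ≈⟨ solve 3 (λ a F G → a :+ F := (F :- G) :+ (a :+ G)) refl (γ ν 0) (∑< K f) (∑< K g) ⟩
      (∑< K f - ∑< K g) + (γ ν 0 + ∑< K g)
        -- The coefficients are free of z, so the same `γ` serve at z = 1. There the product is 0,
        -- as its factor at j = 0 is (1 - 1)².
        ≈⟨ +-congˡ (u-expansion 1# 1# (*-identityˡ 1#) ν K n<K) ⟨
      (∑< K f - ∑< K g) + (1# - 1# * 1#) * (1# - 1# * 1#) * w
        ≈⟨ solve 3 (λ F G w → (F :- G) :+ (𝟙 :- 𝟙 :* 𝟙) :* (𝟙 :- 𝟙 :* 𝟙) :* w
             := F :+ :- 𝟙 :* G) refl (∑< K f) (∑< K g) w ⟩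
      ∑< K f + - 1# * ∑< K g
        ≈⟨ trans (+-congˡ (*-distribˡ-∑< K (- 1#) g)) (sym (∑<-+ K f (λ j → - 1# * g j))) ⟩
      ∑< K (λ j → f j + - 1# * g j)
        ≈⟨ ∑<-cong K (λ j _ → trans
             (+-congˡ (*-congˡ (*-congˡ (+-cong (1^k≈1 (suc j)) (1^k≈1 (suc j))))))
             (solve 2 (λ a x → a :* x :+ :- 𝟙 :* (a :* 𝟚) := a :* (x :- 𝟚))
               refl (γ ν (suc j)) (ψ z z⁻¹ zz⁻¹≈1 (suc j)))) ⟩
      ∑< K (λ j → γ ν (suc j) * (ψ z z⁻¹ zz⁻¹≈1 (suc j) - (1# + 1#))) ∎
      where
      f = λ j → γ ν (suc j) * ψ z z⁻¹ zz⁻¹≈1 (suc j)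
      g = λ j → γ ν (suc j) * ψ 1# 1# (*-identityˡ 1#) (suc j)
      w = ∏< ν (λ j → (1# - 1# * p ^ suc j) * (1# - 1# * p ^ suc j))

-- The Hecke-Rogers double sum, and the partial theta function

module HeckeRogers {c ℓ} (R : CommutativeRing c ℓ) (q : CommutativeRing.Carrier R) where
  open CommutativeRing R
  open Algebra.Properties.Semiring.Exp semiring using (_^_; ^-homo-*; ^-congʳ)
  open IntegerSolver R
  open FiniteSums R
  open Relation.Binary.Reasoning.Setoid setoid

  p : Carrier
  p = q * q

  open Expansion R p public

  p^≈q^ : ∀ k → p ^ k ≈ q ^ (k ℕ.+ k)
  p^≈q^ zero    = refl
  p^≈q^ (suc k) = begin
    q * q * p ^ k           ≈⟨ *-congˡ (p^≈q^ k) ⟩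
    q * q * q ^ (k ℕ.+ k)   ≈⟨ *-assoc _ _ _ ⟩
    q ^ suc (suc (k ℕ.+ k)) ≡⟨ ≡.cong (λ n → q ^ suc n) (ℕ.+-suc k k) ⟨
    q ^ (suc k ℕ.+ suc k)   ∎

  s-closed : ∀ k → s k * q ^ k ≈ (- 1#) ^ k * q ^ (k ℕ.* k)
  s-closed zero    = refl
  s-closed (suc k) = begin
    - (s k * p ^ k) * (q * q ^ k)
      ≈⟨ solve 4 (λ s x q y → :- (s :* x) :* (q :* y) := :- 𝟙 :* (s :* y) :* (q :* x))
           refl (s k) (p ^ k) q (q ^ k) ⟩
    - 1# * (s k * q ^ k) * (q * p ^ k)
      ≈⟨ *-cong (*-congˡ (s-closed k)) (*-congˡ (p^≈q^ k)) ⟩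
    - 1# * ((- 1#) ^ k * q ^ (k ℕ.* k)) * q ^ suc (k ℕ.+ k)
      ≈⟨ trans (*-congʳ (sym (*-assoc _ _ _))) (*-assoc _ _ _) ⟩
    (- 1#) ^ suc k * (q ^ (k ℕ.* k) * q ^ suc (k ℕ.+ k))
      ≈⟨ *-congˡ (^-homo-* q (k ℕ.* k) (suc (k ℕ.+ k))) ⟨
    (- 1#) ^ suc k * q ^ (k ℕ.* k ℕ.+ suc (k ℕ.+ k))
      ≡⟨ ≡.cong (λ n → (- 1#) ^ suc k * q ^ n) (square k) ⟩
    (- 1#) ^ suc k * q ^ (suc k ℕ.* suc k) ∎
    where
    square : ∀ k → k ℕ.* k ℕ.+ suc (k ℕ.+ k) ≡ suc k ℕ.* suc k
    square = ℕ-solve-∀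

  y : ℕ → ℕ → Carrier
  y k m = (- 1#) ^ m * q ^ (triangular m ℕ.+ m ℕ.* (k ℕ.+ k))

  -- Two steps in m amount to one step in k: the triangular number grows by 2m + 3 and 2km by 4k.
  -- The 2m is absorbed by k + 1, and q^(4k+3) comes out.
  y-suc-suc : ∀ k m → y k (suc (suc m)) ≈ q * p * (p ^ k * p ^ k) * y (suc k) m
  y-suc-suc k m = begin
    (- 1# * (- 1# * e)) * q ^ n′
      ≈⟨ *-cong (solve 1 (λ e → :- 𝟙 :* (:- 𝟙 :* e) := e) refl e)
                (trans (^-congʳ q (exponents k m (triangular m))) (^-homo-* q (3 ℕ.+ ((k ℕ.+ k) ℕ.+ (k ℕ.+ k))) n)) ⟩
    e * (q ^ (3 ℕ.+ ((k ℕ.+ k) ℕ.+ (k ℕ.+ k))) * q ^ n)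
      ≈⟨ *-congˡ (*-congʳ (begin
           q * (q * (q * q ^ ((k ℕ.+ k) ℕ.+ (k ℕ.+ k))))
             ≈⟨ *-congˡ (*-congˡ (*-congˡ (^-homo-* q (k ℕ.+ k) (k ℕ.+ k)))) ⟩
           q * (q * (q * (q ^ (k ℕ.+ k) * q ^ (k ℕ.+ k))))
             ≈⟨ *-congˡ (*-congˡ (*-congˡ (*-cong (p^≈q^ k) (p^≈q^ k)))) ⟨
           q * (q * (q * (p ^ k * p ^ k))) ∎)) ⟩
    e * (q * (q * (q * (p ^ k * p ^ k))) * q ^ n)
      ≈⟨ solve 4 (λ q e K x → e :* (q :* (q :* (q :* K)) :* x)
           := q :* (q :* q) :* K :* (e :* x)) refl q e (p ^ k * p ^ k) (q ^ n) ⟩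
    q * p * (p ^ k * p ^ k) * y (suc k) m ∎
    where
    e = (- 1#) ^ m
    n′ = triangular (suc (suc m)) ℕ.+ suc (suc m) ℕ.* (k ℕ.+ k)
    n = triangular m ℕ.+ m ℕ.* (suc k ℕ.+ suc k)
    exponents : ∀ k m t →
      suc (suc m) ℕ.+ (suc m ℕ.+ t) ℕ.+ suc (suc m) ℕ.* (k ℕ.+ k) ≡
      3 ℕ.+ ((k ℕ.+ k) ℕ.+ (k ℕ.+ k)) ℕ.+ (t ℕ.+ m ℕ.* (suc k ℕ.+ suc k))
    exponents = ℕ-solve-∀

  -- Creative telescoping over n

  module Telescope
    (i : ℕ → Carrier) (i-zero : i 0 ≈ 1#) (i-suc : ∀ m → i m ≈ (1# - p ^ suc m) * i (suc m))
    (Q : ℕ → Carrier) (Q-suc : ∀ n → Q n ≈ (1# - q * p ^ n) * (1# - p ^ suc n) * Q (suc n))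
    where
    open Inverse i i-zero i-suc public

    -- With `Q n` = (q²ⁿ⁺¹;q)_∞ and n = ν + 1 this is (q;q)_∞ (-q;q)₂ₙ₋₁: (p;p)₂ₙ₋₁ splits into
    -- (q;q)₂ₙ₋₁ (-q;q)₂ₙ₋₁, and 1 - pⁿ and `Q n` complete the first factor.
    σ : ℕ → Carrier
    σ ν = ρ ν * Q (suc ν)

    σ-suc : ∀ ν → let X = p ^ suc ν in σ (suc ν) ≈ (1# + X) * (1# + q * X) * σ ν
    σ-suc ν = begin
      (1# - p * X) * (1# + X) * (1# - p * (X * X)) * ρ ν * Q′
        ≈⟨ solve 4 (λ q X r Q → let p = q :* q in
             (𝟙 :- p :* X) :* (𝟙 :+ X) :* (𝟙 :- p :* (X :* X)) :* r :* Q
             := (𝟙 :+ X) :* (𝟙 :+ q :* X) :* (r :* ((𝟙 :- q :* X) :* (𝟙 :- p :* X) :* Q)))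
             refl q X (ρ ν) Q′ ⟩
      (1# + X) * (1# + q * X) * (ρ ν * ((1# - q * X) * (1# - p * X) * Q′))
        ≈⟨ *-congˡ (*-congˡ (Q-suc (suc ν))) ⟨
      (1# + X) * (1# + q * X) * σ ν ∎
      where X  = p ^ suc ν
            Q′ = Q (suc (suc ν))

    -- `τ` is the k-th part of pⁿ (q²ⁿ⁺¹;q)_∞ uₙ without its factor `s k * p ^ k`. `H` contains
    -- 1/(p;p)ₙ₋ₖ₋₁, so for k ≥ 1 it vanishes at the lower end n = 1.
    τ H : ℕ → ℕ → Carrier
    τ ν k = p ^ (suc ν ∸ k) * J (suc ν) k * (1# + p ^ k) * i (k ℕ.+ suc ν) * σ ν
    H ν k = (1# - q * p ^ k) * (J (suc ν) (suc k) * i (k ℕ.+ suc ν)) * σ ν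

    p^n*Q*γ : ∀ ν k → p ^ suc ν * Q (suc ν) * γ ν k ≈ s k * (p ^ k * τ ν k)
    p^n*Q*γ ν k = begin
      X * Q (suc ν) * (s k * (1# + p ^ k) * (a * b) * ρ ν)
        ≈⟨ solve 7 (λ X Q s K a b r → X :* Q :* (s :* (𝟙 :+ K) :* (a :* b) :* r)
             := s :* ((X :* a) :* (𝟙 :+ K) :* b :* (r :* Q)))
             refl X (Q (suc ν)) (s k) (p ^ k) a b (ρ ν) ⟩
      s k * (X * a * (1# + p ^ k) * b * σ ν)
        ≈⟨ *-congˡ (*-congʳ (*-congʳ (*-congʳ (p^n*J (suc ν) k)))) ⟩
      s k * (p ^ k * (V * a) * (1# + p ^ k) * b * σ ν)
        ≈⟨ solve 6 (λ K V a b σ s → s :* (K :* (V :* a) :* (𝟙 :+ K) :* b :* σ)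
             := s :* (K :* (V :* a :* (𝟙 :+ K) :* b :* σ)))
             refl (p ^ k) V a b (σ ν) (s k) ⟩
      s k * (p ^ k * τ ν k) ∎
      where X = p ^ suc ν
            V = p ^ (suc ν ∸ k)
            a = J (suc ν) k
            b = i (k ℕ.+ suc ν)

    -- A q-Zeilberger recurrence in k for the summand τ, with certificate H.
    τ-telescope : ∀ ν k → τ ν k - q * p * (p ^ k * p ^ k) * τ ν (suc k) ≈ H (suc ν) k - H ν k
    τ-telescope ν k with ℕ.≤-<-connex k (suc ν)
    ... | inj₁ k≤n = begin
      V * a * (1# + K) * b * S - q * p * (K * K) * (V′ * a′ * (1# + p * K) * b′ * S)
        ≈⟨ solve 9 (λ q K V V′ a a′ b b′ S → let p = q :* q in
             V :* a :* (𝟙 :+ K) :* b :* S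
               :- q :* p :* (K :* K) :* (V′ :* a′ :* (𝟙 :+ p :* K) :* b′ :* S)
             := V :* a :* (𝟙 :+ K) :* b :* S
               :- q :* (K :* K) :* (p :* (V′ :* a′)) :* (𝟙 :+ p :* K) :* b′ :* S)
             refl q K V V′ a a′ b b′ S ⟩
      V * a * (1# + K) * b * S - q * (K * K) * (p * (V′ * a′)) * (1# + p * K) * b′ * S
        ≈⟨ +-cong (*-congʳ (*-congˡ b≈))
             (-‿cong (*-congʳ (*-congʳ (*-congʳ (*-congˡ
               (trans (p*p^[n∸1+k]*J (suc ν) k) (*-congˡ (J-suc k≤n)))))))) ⟩
      V * a * (1# + K) * b″ * S - q * (K * K) * (V * a″) * (1# + p * K) * b′ * S
        -- With V = pⁿ⁻ᵏ and pⁿ = KV, all four terms share the factor `a * b′ * S`. The recurrence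
        -- is then a polynomial identity in q, K and V.
        ≈⟨ solve 6 (λ q K V a b′ S → let p  = q :* q
                                         b″ = (𝟙 :- p :* (K :* (K :* V))) :* b′
                                         a″ = (𝟙 :- V) :* a in
             V :* a :* (𝟙 :+ K) :* b″ :* S
               :- q :* (K :* K) :* (V :* a″) :* (𝟙 :+ p :* K) :* b′ :* S
             := (𝟙 :- q :* K) :* (a :* b′) :* ((𝟙 :+ K :* V) :* (𝟙 :+ q :* (K :* V)) :* S)
                  :- (𝟙 :- q :* K) :* (a″ :* b″) :* S)
             refl q K V a b′ S ⟩
      (1# - q * K) * (a * b′) * ((1# + K * V) * (1# + q * (K * V)) * S)
        - (1# - q * K) * (a″ * b″) * S
        ≈⟨ +-cong (*-cong (*-congˡ (*-congˡ b′≈)) (trans (σ-suc ν)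
               (*-congʳ (*-cong (+-congˡ X≈) (+-congˡ (*-congˡ X≈))))))
             (-‿cong (*-congʳ (*-congˡ (*-cong (J-suc k≤n) b≈)))) ⟨
      H (suc ν) k - H ν k ∎
      where
      K  = p ^ k
      V  = p ^ (suc ν ∸ k)
      V′ = p ^ (suc ν ∸ suc k)
      a  = J (suc ν) k
      a′ = J (suc ν) (suc k)
      a″ = (1# - V) * a
      b  = i (k ℕ.+ suc ν)
      b′ = i (suc (k ℕ.+ suc ν))
      b″ = (1# - p * (K * (K * V))) * b′
      S  = σ ν
      X≈ : p ^ suc ν ≈ K * V
      X≈ = trans (^-congʳ p (≡.sym (ℕ.m+[n∸m]≡n k≤n))) (^-homo-* p k (suc ν ∸ k))
      b≈ : b ≈ b″
      b≈ = trans (i-suc (k ℕ.+ suc ν)) (*-congʳ (+-congˡ (-‿cong (*-congˡ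
             (trans (^-homo-* p k (suc ν)) (*-congˡ X≈))))))
      b′≈ : i (k ℕ.+ suc (suc ν)) ≈ b′
      b′≈ = reflexive (≡.cong i (ℕ.+-suc k (suc ν)))
    ... | inj₂ n<k = begin
      V * a * (1# + K) * b * S - q * p * (K * K) * (V′ * a′ * (1# + p * K) * b′ * S)
        ≈⟨ +-cong (*-congʳ (*-congʳ (*-congʳ (*-congˡ a≈0))))
             (-‿cong (*-congˡ (*-congʳ (*-congʳ (*-congʳ (*-congˡ a′≈0)))))) ⟩
      V * 0# * (1# + K) * b * S - q * p * (K * K) * (V′ * 0# * (1# + p * K) * b′ * S)
        ≈⟨ solve 9 (λ q K V V′ b b′ b″ S S′ → let p = q :* q in
             V :* 𝟘 :* (𝟙 :+ K) :* b :* S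
               :- q :* p :* (K :* K) :* (V′ :* 𝟘 :* (𝟙 :+ p :* K) :* b′ :* S)
             := (𝟙 :- q :* K) :* (𝟘 :* b″) :* S′ :- (𝟙 :- q :* K) :* (𝟘 :* b) :* S)
             refl q K V V′ b b′ b″ S S′ ⟩
      (1# - q * K) * (0# * b″) * S′ - (1# - q * K) * (0# * b) * S
        ≈⟨ +-cong (*-congʳ (*-congˡ (*-congʳ a≈0)))
             (-‿cong (*-congʳ (*-congˡ (*-congʳ a′≈0)))) ⟨
      H (suc ν) k - H ν k ∎
      where
      K  = p ^ k
      V  = p ^ (suc ν ∸ k)
      V′ = p ^ (suc ν ∸ suc k)
      a  = J (suc ν) k
      a′ = J (suc ν) (suc k)
      b  = i (k ℕ.+ suc ν)
      b′ = i (suc (k ℕ.+ suc ν))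
      b″ = i (k ℕ.+ suc (suc ν))
      S  = σ ν
      S′ = σ (suc ν)
      a≈0  = reflexive (J-< n<k)
      a′≈0 = reflexive (J-< (ℕ.m<n⇒m<1+n n<k))

    G : ℕ → ℕ → Carrier
    G M k = ∑< M (λ ν → τ ν k)

    -- Summing `τ-telescope` leaves the two ends of `H`. The lower one contains `J 1 (suc k)`, which
    -- is 0 because k ≥ 1.
    G-recurrence : ∀ M κ → let k = suc κ in
      G M k ≈ H M k + q * p * (p ^ k * p ^ k) * G M (suc k)
    G-recurrence M κ = begin
      G M k
        ≈⟨ solve 3 (λ G x G′ → G := (G :+ :- x :* G′) :+ x :* G′) refl (G M k) x (G M (suc k)) ⟩
      (G M k + - x * G M (suc k)) + x * G M (suc k)
        ≈⟨ +-congʳ (+-congˡ (*-distribˡ-∑< M (- x) (λ ν → τ ν (suc k)))) ⟩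
      (G M k + ∑< M (λ ν → - x * τ ν (suc k))) + x * G M (suc k)
        ≈⟨ +-congʳ (∑<-+ M (λ ν → τ ν k) (λ ν → - x * τ ν (suc k))) ⟨
      ∑< M (λ ν → τ ν k + - x * τ ν (suc k)) + x * G M (suc k)
        ≈⟨ +-congʳ (∑<-cong M (λ ν _ → trans
             (solve 3 (λ a x b → a :+ :- x :* b := a :- x :* b) refl (τ ν k) x (τ ν (suc k)))
             (τ-telescope ν k))) ⟩
      ∑< M (λ ν → H (suc ν) k - H ν k) + x * G M (suc k)
        ≈⟨ +-congʳ (∑<-telescope M (λ ν → H ν k)) ⟩
      (H M k - H 0 k) + x * G M (suc k)
        ≈⟨ +-congʳ (+-congˡ (-‿cong
             (solve 3 (λ a b c → a :* (𝟘 :* b) :* c := 𝟘) refl (1# - q * p ^ k) (i (k ℕ.+ 1)) (σ 0)))) ⟩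
      (H M k - 0#) + x * G M (suc k)
        ≈⟨ +-congʳ (solve 1 (λ h → h :- 𝟘 := h) refl (H M k)) ⟩
      H M k + x * G M (suc k) ∎
      where k = suc κ
            x = q * p * (p ^ k * p ^ k)

  -- Evaluation of the telescoped sums when q is nilpotent

  module Nilpotent (M : ℕ) (q^a≈0 : ∀ a → M ≤ a → q ^ a ≈ 0#)
    (i : ℕ → Carrier) (i-zero : i 0 ≈ 1#) (i-suc : ∀ m → i m ≈ (1# - p ^ suc m) * i (suc m))
    (Q : ℕ → Carrier) (Q-suc : ∀ n → Q n ≈ (1# - q * p ^ n) * (1# - p ^ suc n) * Q (suc n))
    (Q-≥ : ∀ n → M ≤ n → Q n ≈ 1#)
    (P : ℕ → Carrier) (P-suc : ∀ m → P m ≈ (1# - p ^ suc m) * P (suc m))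
    (P-≥ : ∀ m → M ≤ m → P m ≈ 1#)
    (P*i : ∀ m → P 0 * i m ≈ P m)
    where
    open Telescope i i-zero i-suc Q Q-suc

    p^a≈0 : ∀ a → M ≤ a → p ^ a ≈ 0#
    p^a≈0 a M≤a = trans (p^≈q^ a) (q^a≈0 (a ℕ.+ a) (ℕ.≤-trans M≤a (ℕ.m≤m+n a a)))

    -- `P m` plays (pᵐ⁺¹;p)_∞, which is 1 modulo pᵐ⁺¹, and p^a kills that multiple once a + m ≥ M.
    -- The counter t bounds how many factors are peeled off before `P` is 1.
    p^a*P : ∀ a t m → M ≤ t ℕ.+ m → M ≤ a ℕ.+ m → p ^ a * P m ≈ p ^ a
    p^a*P a zero    m M≤m   _     = trans (*-congˡ (P-≥ m M≤m)) (*-identityʳ _)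
    p^a*P a (suc t) m M≤t+m M≤a+m = begin
      p ^ a * P m                                   ≈⟨ *-congˡ (P-suc m) ⟩
      p ^ a * ((1# - p ^ suc m) * P (suc m))
        ≈⟨ solve 3 (λ A B P → A :* ((𝟙 :- B) :* P) := A :* P :- A :* B :* P)
             refl (p ^ a) (p ^ suc m) (P (suc m)) ⟩
      p ^ a * P (suc m) - p ^ a * p ^ suc m * P (suc m)
        ≈⟨ +-cong
             (p^a*P a t (suc m) (≡.subst (M ≤_) (≡.sym (ℕ.+-suc t m)) M≤t+m) M≤a+1+m)
             (-‿cong (*-congʳ (trans (sym (^-homo-* p a (suc m))) (p^a≈0 (a ℕ.+ suc m) M≤a+1+m)))) ⟩
      p ^ a - 0# * P (suc m)
        ≈⟨ solve 2 (λ A P → A :- 𝟘 :* P := A) refl (p ^ a) (P (suc m)) ⟩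
      p ^ a                                         ∎
      where
      M≤a+1+m : M ≤ a ℕ.+ suc m
      M≤a+1+m = ≡.subst (M ≤_) (≡.sym (ℕ.+-suc a m)) (ℕ.m≤n⇒m≤1+n M≤a+m)

    i-≥ : ∀ e → i (M ℕ.+ e) ≈ i M
    i-≥ zero    = reflexive (≡.cong i (ℕ.+-identityʳ M))
    i-≥ (suc e) = begin
      i (M ℕ.+ suc e)                            ≡⟨ ≡.cong i (ℕ.+-suc M e) ⟩
      i (suc (M ℕ.+ e))
        ≈⟨ solve 1 (λ x → x := (𝟙 :- 𝟘) :* x) refl (i (suc (M ℕ.+ e))) ⟩
      (1# - 0#) * i (suc (M ℕ.+ e))
        ≈⟨ *-congʳ (+-congˡ (-‿cong (p^a≈0 (suc (M ℕ.+ e)) (ℕ.m≤n⇒m≤1+n (ℕ.m≤m+n M e))))) ⟨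
      (1# - p ^ suc (M ℕ.+ e)) * i (suc (M ℕ.+ e)) ≈⟨ i-suc (M ℕ.+ e) ⟨
      i (M ℕ.+ e)                                ≈⟨ i-≥ e ⟩
      i M                                        ∎

    -- At this index everything has reached its limit: `i` is 1/(p;p)_∞, `ρ` is (p;p)_∞ by
    -- `ρ-closed`, and `Q` is 1.
    i*σ : ∀ k → i (k ℕ.+ suc M) * σ M ≈ 1#
    i*σ k = begin
      i (k ℕ.+ suc M) * (ρ M * Q (suc M))
        ≈⟨ *-cong (trans (reflexive (≡.cong i (k+1+M k M))) (i-≥ (suc k)))
             (*-cong (ρ-closed M) (Q-≥ (suc M) (ℕ.n≤1+n M))) ⟩
      i M * ((1# - p ^ suc M) * p⨾p (suc (M ℕ.+ M)) * 1#)
        ≈⟨ *-congˡ (*-congʳ (*-congʳ (+-congˡ (-‿cong (p^a≈0 (suc M) (ℕ.n≤1+n M)))))) ⟩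
      i M * ((1# - 0#) * p⨾p (suc (M ℕ.+ M)) * 1#)
        ≈⟨ solve 2 (λ i x → i :* ((𝟙 :- 𝟘) :* x :* 𝟙) := x :* i) refl (i M) (p⨾p (suc (M ℕ.+ M))) ⟩
      p⨾p (suc (M ℕ.+ M)) * i M
        ≈⟨ *-congˡ (trans (reflexive (≡.cong i (≡.sym (ℕ.+-suc M M)))) (i-≥ (suc M))) ⟨
      p⨾p (suc (M ℕ.+ M)) * i (suc (M ℕ.+ M)) ≈⟨ p⨾p-inverse (suc (M ℕ.+ M)) ⟩
      1# ∎
      where
      k+1+M : ∀ k M → k ℕ.+ suc M ≡ M ℕ.+ suc k
      k+1+M = ℕ-solve-∀

    -- For k ≤ M the product `P 0 * J M k` is `P (M ∸ k)`, which is 1 only modulo a power of p above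
    -- M - k. The factor pᵏ makes up the difference; for k > M it is itself 0.
    p^k*P*J : ∀ k → p ^ k * (P 0 * J M k) ≈ p ^ k
    p^k*P*J k with ℕ.≤-<-connex k M
    ... | inj₁ k≤M = begin
      p ^ k * (P 0 * J M k)         ≈⟨ *-congˡ (*-congˡ J≈) ⟩
      p ^ k * (P 0 * i (M ∸ k))     ≈⟨ *-congˡ (P*i (M ∸ k)) ⟩
      p ^ k * P (M ∸ k)             ≈⟨ p^a*P k k (M ∸ k) M≤ M≤ ⟩
      p ^ k                         ∎
      where
      M≤ : M ≤ k ℕ.+ (M ∸ k)
      M≤ = ℕ.m≤n+m∸n M k
      J≈ : J M k ≈ i (M ∸ k)
      J≈ = reflexive (≡.trans (≡.cong (λ n → J n k) (≡.sym (ℕ.m+[n∸m]≡n k≤M))) (J-+ k (M ∸ k)))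
    ... | inj₂ M<k = trans (*-congʳ p^k≈0) (trans (zeroˡ _) (sym p^k≈0))
      where p^k≈0 = p^a≈0 k (ℕ.<⇒≤ M<k)

    -- The upper end of the telescoped sum thus becomes the inhomogeneous term of `f-recurrence`.
    p^k*P*H : ∀ κ → let k = suc κ in p ^ k * (P 0 * H M k) ≈ p ^ k * (1# - q * p ^ k)
    p^k*P*H κ = begin
      p ^ k * (P 0 * ((1# - q * p ^ k) * (J M k * i (k ℕ.+ suc M)) * σ M))
        ≈⟨ solve 6 (λ q K P J i s → K :* (P :* ((𝟙 :- q :* K) :* (J :* i) :* s))
             := K :* (P :* J) :* (i :* s) :* (𝟙 :- q :* K))
             refl q (p ^ k) (P 0) (J M k) (i (k ℕ.+ suc M)) (σ M) ⟩
      p ^ k * (P 0 * J M k) * (i (k ℕ.+ suc M) * σ M) * (1# - q * p ^ k)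
        ≈⟨ *-congʳ (*-cong (p^k*P*J k) (i*σ k)) ⟩
      p ^ k * 1# * (1# - q * p ^ k)     ≈⟨ *-congʳ (*-identityʳ _) ⟩
      p ^ k * (1# - q * p ^ k)          ∎
      where k = suc κ

    f : ℕ → Carrier
    f k = ∑< M (y k)

    y-≥ : ∀ k m → M ≤ m → y k m ≈ 0#
    y-≥ k m M≤m = trans (*-congˡ (q^a≈0 _ (ℕ.≤-trans M≤m
      (ℕ.≤-trans (m≤triangular m) (ℕ.m≤m+n (triangular m) _))))) (zeroʳ _)

    f-recurrence : ∀ k → f k ≈ (1# - q * p ^ k) + q * p * (p ^ k * p ^ k) * f (suc k)
    f-recurrence k = begin
      -- Two vanishing terms are appended first, so that splitting off m = 0 and m = 1 leaves M
      -- terms, the length of `f (suc k)`.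
      ∑< M (y k)         ≈⟨ ∑<-extend 2 M (y k) (y-≥ k) ⟨
      ∑< (M ℕ.+ 2) (y k) ≡⟨ ≡.cong (λ n → ∑< n (y k)) (ℕ.+-comm M 2) ⟩
      1# * 1# + (- 1# * 1# * (q * q ^ (k ℕ.+ k ℕ.+ 0)) + ∑< M (λ m → y k (suc (suc m))))
        ≈⟨ +-congˡ (+-cong
             (*-congˡ (*-congˡ (trans (^-congʳ q (ℕ.+-identityʳ (k ℕ.+ k))) (sym (p^≈q^ k)))))
             (trans (∑<-cong M (λ m _ → y-suc-suc k m))
                    (sym (*-distribˡ-∑< M (q * p * (p ^ k * p ^ k)) (y (suc k)))))) ⟩
      1# * 1# + (- 1# * 1# * (q * p ^ k) + q * p * (p ^ k * p ^ k) * f (suc k))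
        ≈⟨ solve 3 (λ q K f → 𝟙 :* 𝟙 :+ (:- 𝟙 :* 𝟙 :* (q :* K) :+ f)
             := (𝟙 :- q :* K) :+ f) refl q (p ^ k) (q * p * (p ^ k * p ^ k) * f (suc k)) ⟩
      (1# - q * p ^ k) + q * p * (p ^ k * p ^ k) * f (suc k) ∎

    -- Uniqueness for the common recurrence, by descent from large k, where pᵏ is 0; t bounds the
    -- distance. The coefficient q p p²ᵏ supplies the p that turns the prefactor pᵏ into pᵏ⁺¹.
    p^k*P*G : ∀ t κ → let k = suc κ in M ≤ t ℕ.+ k → p ^ k * (P 0 * G M k) ≈ p ^ k * f k
    p^k*P*G zero    κ M≤k   = trans (*-congʳ p^k≈0) (trans (zeroˡ _) (sym (trans (*-congʳ p^k≈0) (zeroˡ _))))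
      where p^k≈0 = p^a≈0 (suc κ) M≤k
    p^k*P*G (suc t) κ M≤t+k = begin
      K * (P 0 * G M k)
        ≈⟨ *-congˡ (*-congˡ (G-recurrence M κ)) ⟩
      K * (P 0 * (H M k + q * p * (K * K) * G M (suc k)))
        ≈⟨ solve 6 (λ q p K P H G → K :* (P :* (H :+ q :* p :* (K :* K) :* G))
             := K :* (P :* H) :+ q :* (K :* K) :* (p :* K :* (P :* G)))
             refl q p K (P 0) (H M k) (G M (suc k)) ⟩
      K * (P 0 * H M k) + q * (K * K) * (p * K * (P 0 * G M (suc k)))
        ≈⟨ +-cong (p^k*P*H κ) (*-congˡ (p^k*P*G t k
             (≡.subst (M ≤_) (≡.sym (ℕ.+-suc t k)) M≤t+k))) ⟩
      K * (1# - q * K) + q * (K * K) * (p * K * f (suc k))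
        ≈⟨ solve 4 (λ q p K f → K :* (𝟙 :- q :* K) :+ q :* (K :* K) :* (p :* K :* f)
             := K :* ((𝟙 :- q :* K) :+ q :* p :* (K :* K) :* f)) refl q p K (f (suc k)) ⟩
      K * ((1# - q * K) + q * p * (K * K) * f (suc k))
        ≈⟨ *-congˡ (f-recurrence k) ⟨
      K * f k ∎
      where k = suc κ
            K = p ^ k

    module _ (z z⁻¹ : Carrier) (zz⁻¹≈1 : z * z⁻¹ ≈ 1#) where

      w : ℕ → Carrier
      w k = ψ z z⁻¹ zz⁻¹≈1 k - (1# + 1#)

      -- The term of the double sum in the coordinates k = n - m and m.
      F : ℕ → ℕ → Carrier
      F k m = w k * ((- 1#) ^ (k ℕ.+ m)
                     * q ^ (k ℕ.* k ℕ.+ k ℕ.+ (triangular m ℕ.+ m ℕ.* (k ℕ.+ k))))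

      F-≥ : ∀ k m → M ≤ k ℕ.+ m → F k m ≈ 0#
      F-≥ k m M≤k+m = trans (*-congˡ (trans (*-congˡ (q^a≈0 _ (ℕ.≤-trans M≤k+m
        (ℕ.+-mono-≤ (ℕ.m≤n+m k (k ℕ.* k)) (ℕ.≤-trans (m≤triangular m) (ℕ.m≤m+n (triangular m) _))))))
        (zeroʳ _))) (zeroʳ _)

      F-closed : ∀ k m → F k m ≈ w k * (s k * p ^ k) * y k m
      F-closed k m = begin
        w k * ((- 1#) ^ (k ℕ.+ m) * q ^ (k ℕ.* k ℕ.+ k ℕ.+ e))
          ≈⟨ *-congˡ (*-cong (^-homo-* (- 1#) k m)
               (trans (^-homo-* q (k ℕ.* k ℕ.+ k) e) (*-congʳ (^-homo-* q (k ℕ.* k) k)))) ⟩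
        w k * ((- 1#) ^ k * (- 1#) ^ m * (q ^ (k ℕ.* k) * q ^ k * q ^ e))
          ≈⟨ solve 6 (λ w a b c d e → w :* (a :* b :* (c :* d :* e))
               := w :* (a :* c :* d) :* (b :* e)) refl
               (w k) ((- 1#) ^ k) ((- 1#) ^ m) (q ^ (k ℕ.* k)) (q ^ k) (q ^ e) ⟩
        w k * ((- 1#) ^ k * q ^ (k ℕ.* k) * q ^ k) * y k m
          ≈⟨ *-congʳ (*-congˡ (*-congʳ (s-closed k))) ⟨
        w k * (s k * q ^ k * q ^ k) * y k m
          ≈⟨ *-congʳ (*-congˡ (trans (*-assoc _ _ _)
               (*-congˡ (trans (sym (^-homo-* q k k)) (sym (p^≈q^ k)))))) ⟩
        w k * (s k * p ^ k) * y k m ∎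
        where e = triangular m ℕ.+ m ℕ.* (k ℕ.+ k)

      w-zero : w 0 ≈ 0#
      w-zero = -‿inverseʳ (1# + 1#)

      ∑F : ∀ j → ∑< M (F (suc j)) ≈ w (suc j) * (s (suc j) * (p ^ suc j * f (suc j)))
      ∑F j = begin
        ∑< M (F k)                              ≈⟨ ∑<-cong M (λ m _ → F-closed k m) ⟩
        ∑< M (λ m → w k * (s k * p ^ k) * y k m) ≈⟨ *-distribˡ-∑< M (w k * (s k * p ^ k)) (y k) ⟨
        w k * (s k * p ^ k) * f k
          ≈⟨ solve 4 (λ w s K f → w :* (s :* K) :* f := w :* (s :* (K :* f)))
               refl (w k) (s k) (p ^ k) (f k) ⟩
        w k * (s k * (p ^ k * f k))             ∎
        where k = suc j

      -- Both sides are sums over k ≥ 1 of `w k * (s k * (p ^ k * f k))`: the left one after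
      -- expanding uₙ and exchanging the sums, the right one after sorting the triangle by k = n -
      -- m.
      hecke-rogers :
        P 0 * ∑< M (λ ν → p ^ suc ν * Q (suc ν) * u z z⁻¹ zz⁻¹≈1 (suc ν)) ≈
        ∑< M (λ n → ∑< (suc n) (λ m → F (n ∸ m) m))
      hecke-rogers = begin
        P 0 * ∑< M (λ ν → p ^ suc ν * Q (suc ν) * u z z⁻¹ zz⁻¹≈1 (suc ν))
          ≈⟨ *-congˡ (∑<-cong M (λ ν ν<M → begin
               x ν * u z z⁻¹ zz⁻¹≈1 (suc ν)
                 ≈⟨ *-congˡ (u-expansion′ z z⁻¹ zz⁻¹≈1 ν K (s<s (ℕ.m<n⇒m<1+n ν<M))) ⟩
               x ν * ∑< K (λ j → γ ν (suc j) * w (suc j))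
                 ≈⟨ *-distribˡ-∑< K (x ν) (λ j → γ ν (suc j) * w (suc j)) ⟩
               ∑< K (λ j → x ν * (γ ν (suc j) * w (suc j)))
                 ≈⟨ ∑<-cong K (λ j _ → trans (sym (*-assoc _ _ _))
                      (trans (*-congʳ (p^n*Q*γ ν (suc j)))
                        (solve 4 (λ s K t w → s :* (K :* t) :* w := w :* s :* K :* t) refl
                          (s (suc j)) (p ^ suc j) (τ ν (suc j)) (w (suc j))))) ⟩
               ∑< K (λ j → w (suc j) * s (suc j) * p ^ suc j * τ ν (suc j)) ∎)) ⟩
        P 0 * ∑< M (λ ν → ∑< K (λ j → w (suc j) * s (suc j) * p ^ suc j * τ ν (suc j)))
          ≈⟨ *-congˡ (∑<-comm M K (λ ν j → w (suc j) * s (suc j) * p ^ suc j * τ ν (suc j))) ⟩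
        P 0 * ∑< K (λ j → ∑< M (λ ν → w (suc j) * s (suc j) * p ^ suc j * τ ν (suc j)))
          ≈⟨ *-distribˡ-∑< K (P 0)
               (λ j → ∑< M (λ ν → w (suc j) * s (suc j) * p ^ suc j * τ ν (suc j))) ⟩
        ∑< K (λ j → P 0 * ∑< M (λ ν → w (suc j) * s (suc j) * p ^ suc j * τ ν (suc j)))
          ≈⟨ ∑<-cong K (λ j _ → begin
               P 0 * ∑< M (λ ν → w (suc j) * s (suc j) * p ^ suc j * τ ν (suc j))
                 ≈⟨ *-congˡ (*-distribˡ-∑< M (w (suc j) * s (suc j) * p ^ suc j) (λ ν → τ ν (suc j))) ⟨
               P 0 * (w (suc j) * s (suc j) * p ^ suc j * G M (suc j))
                 ≈⟨ solve 5 (λ P w s K G → P :* (w :* s :* K :* G) := w :* (s :* (K :* (P :* G))))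
                      refl (P 0) (w (suc j)) (s (suc j)) (p ^ suc j) (G M (suc j)) ⟩
               w (suc j) * (s (suc j) * (p ^ suc j * (P 0 * G M (suc j))))
                 ≈⟨ *-congˡ (*-congˡ (p^k*P*G M j (ℕ.m≤m+n M (suc j)))) ⟩
               w (suc j) * (s (suc j) * (p ^ suc j * f (suc j)))
                 ≈⟨ ∑F j ⟨
               ∑< M (F (suc j)) ∎) ⟩
        ∑< K (λ j → ∑< M (F (suc j)))
          ≈⟨ +-identityˡ _ ⟨
        0# + ∑< K (λ j → ∑< M (F (suc j)))
          -- The expansion has no term k = 0, but the triangle has a row m = n; its terms contain
          -- `w 0`, which is 0.
          ≈⟨ +-congʳ (∑<-zero M {F 0} (λ m _ → trans (*-congʳ w-zero) (zeroˡ _))) ⟨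
        ∑< (suc K) (λ k → ∑< M (F k))
          ≡⟨ ≡.cong (λ n → ∑< n (λ k → ∑< M (F k))) (ℕ.+-comm 3 M) ⟩
        ∑< (M ℕ.+ 3) (λ k → ∑< M (F k))
          ≈⟨ ∑<-triangle M 3 F F-≥ ⟨
        ∑< M (λ n → ∑< (suc n) (λ m → F (n ∸ m) m)) ∎
        where
        -- A bound above every degree ν + 1 ≤ M, independent of ν so that the two sums can be
        -- exchanged.
        K = 2 ℕ.+ M
        x = λ ν → p ^ suc ν * Q (suc ν)

-- Infinite products modulo a power of q, and the spt-crank series

module Pochhammer {c ℓ} (R : CommutativeRing c ℓ) (q : CommutativeRing.Carrier R) where
  open CommutativeRing R
  open Algebra.Properties.Semiring.Exp semiring using (_^_)
  open IntegerSolver R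
  open FiniteSums R
  open HeckeRogers R q
  open Relation.Binary.Reasoning.Setoid setoid

  module Truncated (M : ℕ) (q^a≈0 : ∀ a → M ≤ a → q ^ a ≈ 0#) where

    -- As qᴹ vanishes, this is (a;p)_∞.
    poch : Carrier → Carrier
    poch a = ∏< M (λ k → 1# - a * p ^ k)

    private
      p^a≈0 : ∀ a → M ≤ a → p ^ a ≈ 0#
      p^a≈0 a M≤a = trans (p^≈q^ a) (q^a≈0 (a ℕ.+ a) (ℕ.≤-trans M≤a (ℕ.m≤m+n a a)))

    poch-cong : ∀ {a b} → a ≈ b → poch a ≈ poch b
    poch-cong a≈b = ∏<-cong M (λ k _ → +-congˡ (-‿cong (*-congʳ a≈b)))

    -- Both products have M factors. The one that the shift adds at the end is 1 - a p^M, which is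
    -- 1.
    poch-suc : ∀ a → poch a ≈ (1# - a) * poch (a * p)
    poch-suc a = begin
      poch a                   ≈⟨ *-identityʳ _ ⟨
      poch a * 1#              ≈⟨ *-congˡ (solve 1 (λ a → 𝟙 := 𝟙 :- a :* 𝟘) refl a) ⟩
      poch a * (1# - a * 0#)   ≈⟨ *-congˡ (+-congˡ (-‿cong (*-congˡ (p^a≈0 M ℕ.≤-refl)))) ⟨
      poch a * f M             ≈⟨ ∏<-last M f ⟨
      (1# - a * 1#) * ∏< M (f ∘ suc)
        ≈⟨ *-cong (+-congˡ (-‿cong (*-identityʳ a)))
                  (∏<-cong M (λ k _ → +-congˡ (-‿cong (sym (*-assoc a p (p ^ k)))))) ⟩
      (1# - a) * poch (a * p) ∎
      where f = λ k → 1# - a * p ^ k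

    poch-0 : ∀ a → a ≈ 0# → poch a ≈ 1#
    poch-0 a a≈0 = go M
      where
      go : ∀ n → ∏< n (λ k → 1# - a * p ^ k) ≈ 1#
      go zero    = refl
      go (suc n) = trans (∏<-last n (λ k → 1# - a * p ^ k)) (trans
        (*-cong (go n) (+-congˡ (-‿cong (*-congʳ a≈0))))
        (solve 1 (λ x → 𝟙 :* (𝟙 :- 𝟘 :* x) := 𝟙) refl (p ^ n)))

    -- `Q n` is (q²ⁿ⁺¹;q)_∞, with its odd and its even powers of q in separate factors.
    P Q : ℕ → Carrier
    P m = poch (p ^ suc m)
    Q n = poch (q * p ^ n) * poch (p ^ suc n)

    P-suc : ∀ m → P m ≈ (1# - p ^ suc m) * P (suc m)
    P-suc m = trans (poch-suc (p ^ suc m)) (*-congˡ (poch-cong (*-comm (p ^ suc m) p)))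

    P-≥ : ∀ m → M ≤ m → P m ≈ 1#
    P-≥ m M≤m = poch-0 (p ^ suc m) (p^a≈0 (suc m) (ℕ.m≤n⇒m≤1+n M≤m))

    Q-suc : ∀ n → Q n ≈ (1# - q * p ^ n) * (1# - p ^ suc n) * Q (suc n)
    Q-suc n = begin
      poch (q * p ^ n) * P n
        ≈⟨ *-cong (trans (poch-suc (q * p ^ n)) (*-congˡ (poch-cong
             (solve 3 (λ q p x → q :* x :* p := q :* (p :* x)) refl q p (p ^ n))))) (P-suc n) ⟩
      (1# - q * p ^ n) * poch (q * p ^ suc n) * ((1# - p ^ suc n) * P (suc n))
        ≈⟨ solve 4 (λ a b c d → a :* b :* (c :* d) := a :* c :* (b :* d)) refl _ _ _ _ ⟩
      (1# - q * p ^ n) * (1# - p ^ suc n) * Q (suc n) ∎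

    Q-≥ : ∀ n → M ≤ n → Q n ≈ 1#
    Q-≥ n M≤n = trans
      (*-cong (poch-0 (q * p ^ n) (trans (*-congˡ (p^a≈0 n M≤n)) (zeroʳ q))) (P-≥ n M≤n))
      (*-identityˡ 1#)

    module SptCrank (z z⁻¹ : Carrier) (zz⁻¹≈1 : z * z⁻¹ ≈ 1#)
             (P₀⁻¹ : Carrier) (P₀*P₀⁻¹≈1 : poch p * P₀⁻¹ ≈ 1#) where

      private
        -- 1/(p;p)ₘ as (pᵐ⁺¹;p)_∞ / (p;p)_∞, so that one inverse suffices for all m.
        i : ℕ → Carrier
        i m = P₀⁻¹ * P m

        P₀≈ : P 0 ≈ poch p
        P₀≈ = poch-cong (*-identityʳ p)

        i-zero : i 0 ≈ 1#
        i-zero = trans (*-congˡ P₀≈) (trans (*-comm _ _) P₀*P₀⁻¹≈1)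

        i-suc : ∀ m → i m ≈ (1# - p ^ suc m) * i (suc m)
        i-suc m = trans (*-congˡ (P-suc m))
          (solve 3 (λ a b c → a :* (b :* c) := b :* (a :* c)) refl _ _ _)

        P*i : ∀ m → P 0 * i m ≈ P m
        P*i m = begin
          P 0 * (P₀⁻¹ * P m)    ≈⟨ *-assoc _ _ _ ⟨
          P 0 * P₀⁻¹ * P m      ≈⟨ *-congʳ (trans (*-congʳ P₀≈) P₀*P₀⁻¹≈1) ⟩
          1# * P m              ≈⟨ *-identityˡ _ ⟩
          P m                   ∎

      open Telescope i i-zero i-suc Q Q-suc using (u)
      open Nilpotent M q^a≈0 i i-zero i-suc Q Q-suc Q-≥ P P-suc P-≥ P*i public using (F; hecke-rogers)

      denominator : ℕ → Carrier
      denominator n = poch (z * p ^ n) * poch (z⁻¹ * p ^ n)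

      -- Splits off the first n factors of both products. The prefactor of the theorem thereby
      -- cancels the denominator of the n-th term, although it is itself not invertible.
      u*denominator : ∀ n → poch z * poch z⁻¹ ≈ u z z⁻¹ zz⁻¹≈1 n * denominator n
      u*denominator zero    = sym (trans (*-identityˡ _)
        (*-cong (poch-cong (*-identityʳ z)) (poch-cong (*-identityʳ z⁻¹))))
      u*denominator (suc n) = begin
        poch z * poch z⁻¹                                            ≈⟨ u*denominator n ⟩
        U n * (poch (z * p ^ n) * poch (z⁻¹ * p ^ n))
          ≈⟨ *-congˡ (*-cong (step z) (step z⁻¹)) ⟩
        U n * ((1# - z * p ^ n) * poch (z * p ^ suc n) * ((1# - z⁻¹ * p ^ n) * poch (z⁻¹ * p ^ suc n)))
          ≈⟨ solve 5 (λ u a b c d → u :* (a :* b :* (c :* d)) := u :* (a :* c) :* (b :* d))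
               refl (U n) _ _ _ _ ⟩
        U n * ((1# - z * p ^ n) * (1# - z⁻¹ * p ^ n)) * denominator (suc n)
          ≈⟨ *-congʳ (∏<-last n (λ j → (1# - z * p ^ j) * (1# - z⁻¹ * p ^ j))) ⟨
        U (suc n) * denominator (suc n) ∎
        where
        U = u z z⁻¹ zz⁻¹≈1
        step : ∀ a → poch (a * p ^ n) ≈ (1# - a * p ^ n) * poch (a * p ^ suc n)
        step a = trans (poch-suc (a * p ^ n)) (*-congˡ (poch-cong
          (solve 3 (λ a p x → a :* x :* p := a :* (p :* x)) refl a p (p ^ n))))

      spt-crank : (t : ℕ → Carrier) →
        (∀ ν → let n = suc ν in
          denominator n * t ν ≈ p ^ n * poch (p ^ suc n) * poch (q * p ^ n)) →
        poch z * poch z⁻¹ * poch p * ∑< M t ≈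
        ∑< M (λ n → ∑< (suc n) (λ m → F z z⁻¹ zz⁻¹≈1 (n ∸ m) m))
      spt-crank t denominator*t = begin
        poch z * poch z⁻¹ * poch p * ∑< M t
          ≈⟨ solve 3 (λ a b c → a :* b :* c := b :* (a :* c)) refl (poch z * poch z⁻¹) (poch p) (∑< M t) ⟩
        poch p * (poch z * poch z⁻¹ * ∑< M t)
          ≈⟨ *-cong (sym P₀≈) (*-distribˡ-∑< M (poch z * poch z⁻¹) t) ⟩
        P 0 * ∑< M (λ ν → poch z * poch z⁻¹ * t ν)
          ≈⟨ *-congˡ (∑<-cong M (λ ν _ → begin
               poch z * poch z⁻¹ * t ν                  ≈⟨ *-congʳ (u*denominator (suc ν)) ⟩
               U ν * denominator (suc ν) * t ν          ≈⟨ *-assoc _ _ _ ⟩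
               U ν * (denominator (suc ν) * t ν)        ≈⟨ *-congˡ (denominator*t ν) ⟩
               U ν * (p ^ suc ν * P (suc ν) * poch (q * p ^ suc ν))
                 ≈⟨ solve 4 (λ u x e o → u :* (x :* e :* o) := x :* (o :* e) :* u)
                      refl (U ν) (p ^ suc ν) (P (suc ν)) (poch (q * p ^ suc ν)) ⟩
               p ^ suc ν * Q (suc ν) * U ν ∎)) ⟩
        P 0 * ∑< M (λ ν → p ^ suc ν * Q (suc ν) * U ν)
          ≈⟨ hecke-rogers z z⁻¹ zz⁻¹≈1 ⟩
        ∑< M (λ n → ∑< (suc n) (λ m → F z z⁻¹ zz⁻¹≈1 (n ∸ m) m)) ∎
        where U = λ ν → u z z⁻¹ zz⁻¹≈1 (suc ν)

-- Laurent polynomials form a commutative ring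

module LaurentRing where
  open RawRing ℤ[z^±1]
  open ≡ using (refl; sym; trans; cong; cong₂; module ≡-Reasoning)
  open ≡-Reasoning

  -- A formal sum acting on an arbitrary coefficient function. Through `coeff-*` a product depends
  -- on its right factor only via the coefficients, and by `convolve-*` associativity is composition
  -- of actions.
  convolve : Laurent → (ℤ → ℤ) → ℤ → ℤ
  convolve []            g k = 0ℤ
  convolve ((c , i) ∷ p) g k = c ℤ.* g (k ℤ.- i) ℤ.+ convolve p g k

  δ : ℤ → ℤ → ℤ → ℤ
  δ c i k = if does (i ℤ.≟ k) then c else 0ℤ

  coeff-++ : ∀ p r k → coeff (p ++ r) k ≡ coeff p k ℤ.+ coeff r k
  coeff-++ []            r k = sym (ℤ.+-identityˡ _)
  coeff-++ ((c , i) ∷ p) r k = trans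
    (cong (λ x → δ c i k ℤ.+ x) (coeff-++ p r k))
    (sym (ℤ.+-assoc (δ c i k) (coeff p k) (coeff r k)))

  δ-neg : ∀ c i k → δ (ℤ.- c) i k ≡ ℤ.- δ c i k
  δ-neg c i k with does (i ℤ.≟ k)
  ... | true  = refl
  ... | false = refl

  coeff-neg : ∀ p k → coeff (- p) k ≡ ℤ.- coeff p k
  coeff-neg []            k = refl
  coeff-neg ((c , i) ∷ p) k = trans
    (cong₂ ℤ._+_ (δ-neg c i k) (coeff-neg p k))
    (sym (ℤ.neg-distrib-+ (δ c i k) (coeff p k)))

  swap-exponents : ∀ {i} j k → i ≡ k ℤ.- j → j ≡ k ℤ.- i
  swap-exponents j k refl = k-[k-j] j k
    where
    k-[k-j] : ∀ j k → j ≡ k ℤ.- (k ℤ.- j)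
    k-[k-j] = ℤ-solve-∀

  -- Both sides are cd if i + j = k and 0 otherwise. This is commutativity for two monomials.
  δ-swap : ∀ c i d j k → d ℤ.* δ c i (k ℤ.- j) ≡ c ℤ.* δ d j (k ℤ.- i)
  δ-swap c i d j k with i ℤ.≟ k ℤ.- j | j ℤ.≟ k ℤ.- i
  ... | yes _  | yes _  = ℤ.*-comm d c
  ... | no  _  | no  _  = trans (ℤ.*-zeroʳ d) (sym (ℤ.*-zeroʳ c))
  ... | yes i≡ | no  j≢ = contradiction (swap-exponents j k i≡) j≢
  ... | no  i≢ | yes j≡ = contradiction (swap-exponents i k j≡) i≢

  δ-* : ∀ c i d j k → δ (c ℤ.* d) (i ℤ.+ j) k ≡ c ℤ.* δ d j (k ℤ.- i)
  δ-* c i d j k with i ℤ.+ j ℤ.≟ k | j ℤ.≟ k ℤ.- i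
  ... | yes _   | yes _  = refl
  ... | no  _   | no  _  = sym (ℤ.*-zeroʳ c)
  ... | yes eq  | no  j≢ = contradiction (trans (j≡i+j-i i j) (cong (ℤ._- i) eq)) j≢
    where
    j≡i+j-i : ∀ i j → j ≡ i ℤ.+ j ℤ.- i
    j≡i+j-i = ℤ-solve-∀
  ... | no  neq | yes j≡ = contradiction (trans (cong (λ x → i ℤ.+ x) j≡) (i+[k-i]≡k i k)) neq
    where
    i+[k-i]≡k : ∀ i k → i ℤ.+ (k ℤ.- i) ≡ k
    i+[k-i]≡k = ℤ-solve-∀

  coeff-monomial-* : ∀ c i r k →
    coeff (map (λ (d , j) → c ℤ.* d , i ℤ.+ j) r) k ≡ c ℤ.* coeff r (k ℤ.- i)
  coeff-monomial-* c i []            k = sym (ℤ.*-zeroʳ c)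
  coeff-monomial-* c i ((d , j) ∷ r) k = trans
    (cong₂ ℤ._+_ (δ-* c i d j k) (coeff-monomial-* c i r k))
    (sym (ℤ.*-distribˡ-+ c (δ d j (k ℤ.- i)) (coeff r (k ℤ.- i))))

  coeff-* : ∀ p r k → coeff (p * r) k ≡ convolve p (coeff r) k
  coeff-* []            r k = refl
  coeff-* ((c , i) ∷ p) r k = trans
    (coeff-++ (map (λ (d , j) → c ℤ.* d , i ℤ.+ j) r) (p * r) k)
    (cong₂ ℤ._+_ (coeff-monomial-* c i r k) (coeff-* p r k))

  convolve-cong : ∀ p {g h} → (∀ k → g k ≡ h k) → ∀ k → convolve p g k ≡ convolve p h k
  convolve-cong []            g≗h k = refl
  convolve-cong ((c , i) ∷ p) g≗h k =
    cong₂ ℤ._+_ (cong (c ℤ.*_) (g≗h (k ℤ.- i))) (convolve-cong p g≗h k)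

  convolve-++ : ∀ p r g k → convolve (p ++ r) g k ≡ convolve p g k ℤ.+ convolve r g k
  convolve-++ []            r g k = sym (ℤ.+-identityˡ _)
  convolve-++ ((c , i) ∷ p) r g k = trans
    (cong (λ x → c ℤ.* g (k ℤ.- i) ℤ.+ x) (convolve-++ p r g k))
    (sym (ℤ.+-assoc (c ℤ.* g (k ℤ.- i)) (convolve p g k) (convolve r g k)))

  convolve-0 : ∀ p k → convolve p (λ _ → 0ℤ) k ≡ 0ℤ
  convolve-0 []            k = refl
  convolve-0 ((c , i) ∷ p) k = cong₂ ℤ._+_ (ℤ.*-zeroʳ c) (convolve-0 p k)

  convolve-+ : ∀ p g h k →
    convolve p (λ k → g k ℤ.+ h k) k ≡ convolve p g k ℤ.+ convolve p h k
  convolve-+ []            g h k = refl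
  convolve-+ ((c , i) ∷ p) g h k = trans
    (cong (λ x → c ℤ.* (g (k ℤ.- i) ℤ.+ h (k ℤ.- i)) ℤ.+ x) (convolve-+ p g h k))
    (interchange c (g (k ℤ.- i)) (h (k ℤ.- i)) (convolve p g k) (convolve p h k))
    where
    interchange : ∀ c x y a b → c ℤ.* (x ℤ.+ y) ℤ.+ (a ℤ.+ b) ≡ (c ℤ.* x ℤ.+ a) ℤ.+ (c ℤ.* y ℤ.+ b)
    interchange = ℤ-solve-∀

  convolve-δ : ∀ c i r k → convolve r (δ c i) k ≡ c ℤ.* coeff r (k ℤ.- i)
  convolve-δ c i []            k = sym (ℤ.*-zeroʳ c)
  convolve-δ c i ((d , j) ∷ r) k = trans
    (cong₂ ℤ._+_ (δ-swap c i d j k) (convolve-δ c i r k))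
    (sym (ℤ.*-distribˡ-+ c (δ d j (k ℤ.- i)) (coeff r (k ℤ.- i))))

  convolve-comm : ∀ p r k → convolve p (coeff r) k ≡ convolve r (coeff p) k
  convolve-comm []            r k = sym (convolve-0 r k)
  convolve-comm ((c , i) ∷ p) r k = sym (trans (convolve-+ r (δ c i) (coeff p) k)
    (cong₂ ℤ._+_ (convolve-δ c i r k) (sym (convolve-comm p r k))))

  convolve-monomial-* : ∀ c i r g k →
    convolve (map (λ (d , j) → c ℤ.* d , i ℤ.+ j) r) g k ≡ c ℤ.* convolve r g (k ℤ.- i)
  convolve-monomial-* c i []            g k = sym (ℤ.*-zeroʳ c)
  convolve-monomial-* c i ((d , j) ∷ r) g k = begin
    c ℤ.* d ℤ.* g (k ℤ.- (i ℤ.+ j)) ℤ.+ convolve (map _ r) g k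
      ≡⟨ cong₂ ℤ._+_ (cong (λ m → c ℤ.* d ℤ.* g m) (k-[i+j] k i j)) (convolve-monomial-* c i r g k) ⟩
    c ℤ.* d ℤ.* g (k ℤ.- i ℤ.- j) ℤ.+ c ℤ.* convolve r g (k ℤ.- i)
      ≡⟨ factor c d (g (k ℤ.- i ℤ.- j)) (convolve r g (k ℤ.- i)) ⟩
    c ℤ.* (d ℤ.* g (k ℤ.- i ℤ.- j) ℤ.+ convolve r g (k ℤ.- i)) ∎
    where
    k-[i+j] : ∀ k i j → k ℤ.- (i ℤ.+ j) ≡ k ℤ.- i ℤ.- j
    k-[i+j] = ℤ-solve-∀
    factor : ∀ c d x y → c ℤ.* d ℤ.* x ℤ.+ c ℤ.* y ≡ c ℤ.* (d ℤ.* x ℤ.+ y)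
    factor = ℤ-solve-∀

  convolve-* : ∀ p r g k → convolve (p * r) g k ≡ convolve p (convolve r g) k
  convolve-* []            r g k = refl
  convolve-* ((c , i) ∷ p) r g k = trans
    (convolve-++ (map (λ (d , j) → c ℤ.* d , i ℤ.+ j) r) (p * r) g k)
    (cong₂ ℤ._+_ (convolve-monomial-* c i r g k) (convolve-* p r g k))

  *-congˡ : ∀ p {r s} → r ≈ s → p * r ≈ p * s
  *-congˡ p {r} {s} r≈s k =
    trans (coeff-* p r k) (trans (convolve-cong p r≈s k) (sym (coeff-* p s k)))

  *-comm : ∀ p r → p * r ≈ r * p
  *-comm p r k = trans (coeff-* p r k) (trans (convolve-comm p r k) (sym (coeff-* r p k)))

  -- Recursion on the list in the left factor does not respect `≈`, so commutativity brings that
  -- factor to the right, where `*-congˡ` applies.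
  *-cong : ∀ {p p′ r r′} → p ≈ p′ → r ≈ r′ → p * r ≈ p′ * r′
  *-cong {p} {p′} {r} {r′} p≈p′ r≈r′ k = begin
    coeff (p * r) k   ≡⟨ *-congˡ p r≈r′ k ⟩
    coeff (p * r′) k  ≡⟨ *-comm p r′ k ⟩
    coeff (r′ * p) k  ≡⟨ *-congˡ r′ p≈p′ k ⟩
    coeff (r′ * p′) k ≡⟨ *-comm r′ p′ k ⟩
    coeff (p′ * r′) k ∎

  *-assoc : ∀ p r s → (p * r) * s ≈ p * (r * s)
  *-assoc p r s k = begin
    coeff ((p * r) * s) k              ≡⟨ coeff-* (p * r) s k ⟩
    convolve (p * r) (coeff s) k       ≡⟨ convolve-* p r (coeff s) k ⟩
    convolve p (convolve r (coeff s)) k ≡⟨ convolve-cong p (coeff-* r s) k ⟨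
    convolve p (coeff (r * s)) k       ≡⟨ coeff-* p (r * s) k ⟨
    coeff (p * (r * s)) k              ∎

  *-identityˡ : ∀ p → 1# * p ≈ p
  *-identityˡ p k = begin
    coeff (1# * p) k                             ≡⟨ coeff-* 1# p k ⟩
    1ℤ ℤ.* coeff p (k ℤ.- 0ℤ) ℤ.+ 0ℤ             ≡⟨ ℤ.+-identityʳ _ ⟩
    1ℤ ℤ.* coeff p (k ℤ.- 0ℤ)                    ≡⟨ ℤ.*-identityˡ _ ⟩
    coeff p (k ℤ.- 0ℤ)                           ≡⟨ cong (coeff p) (ℤ.+-identityʳ k) ⟩
    coeff p k                                    ∎

  *-distribʳ-+ : ∀ s p r → (p + r) * s ≈ p * s + r * s
  *-distribʳ-+ s p r k = begin
    coeff ((p ++ r) * s) k                              ≡⟨ coeff-* (p ++ r) s k ⟩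
    convolve (p ++ r) (coeff s) k                       ≡⟨ convolve-++ p r (coeff s) k ⟩
    convolve p (coeff s) k ℤ.+ convolve r (coeff s) k   ≡⟨ cong₂ ℤ._+_ (coeff-* p s k) (coeff-* r s k) ⟨
    coeff (p * s) k ℤ.+ coeff (r * s) k                 ≡⟨ coeff-++ (p * s) (r * s) k ⟨
    coeff (p * s ++ r * s) k                            ∎

  +-cong : ∀ {p p′ r r′} → p ≈ p′ → r ≈ r′ → p + r ≈ p′ + r′
  +-cong {p} {p′} {r} {r′} p≈p′ r≈r′ k = begin
    coeff (p ++ r) k             ≡⟨ coeff-++ p r k ⟩
    coeff p k ℤ.+ coeff r k      ≡⟨ cong₂ ℤ._+_ (p≈p′ k) (r≈r′ k) ⟩
    coeff p′ k ℤ.+ coeff r′ k    ≡⟨ coeff-++ p′ r′ k ⟨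
    coeff (p′ ++ r′) k           ∎

  +-comm : ∀ p r → p + r ≈ r + p
  +-comm p r k = begin
    coeff (p ++ r) k             ≡⟨ coeff-++ p r k ⟩
    coeff p k ℤ.+ coeff r k      ≡⟨ ℤ.+-comm (coeff p k) (coeff r k) ⟩
    coeff r k ℤ.+ coeff p k      ≡⟨ coeff-++ r p k ⟨
    coeff (r ++ p) k             ∎

  -‿inverseˡ : ∀ p → - p + p ≈ 0#
  -‿inverseˡ p k = begin
    coeff (- p ++ p) k           ≡⟨ coeff-++ (- p) p k ⟩
    coeff (- p) k ℤ.+ coeff p k  ≡⟨ cong (ℤ._+ coeff p k) (coeff-neg p k) ⟩
    ℤ.- coeff p k ℤ.+ coeff p k  ≡⟨ ℤ.+-inverseˡ (coeff p k) ⟩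
    0ℤ                           ∎

  -‿cong : ∀ {p r} → p ≈ r → - p ≈ - r
  -‿cong {p} {r} p≈r k = trans (coeff-neg p k) (trans (cong ℤ.-_ (p≈r k)) (sym (coeff-neg r k)))

  commutativeRing : CommutativeRing 0ℓ 0ℓ
  commutativeRing = record
    { Carrier = Laurent
    ; _≈_ = _≈_
    ; _+_ = _+_
    ; _*_ = _*_
    ; -_  = -_
    ; 0#  = 0#
    ; 1#  = 1#
    ; isCommutativeRing = record
      { isRing = record
        { +-isAbelianGroup = record
          { isGroup = record
            { isMonoid = record
              { isSemigroup = record
                { isMagma = record
                  { isEquivalence = ≈-isEquivalence
                  ; ∙-cong = λ {p} {p′} {r} {r′} → +-cong {p} {p′} {r} {r′}
                  }
                ; assoc = λ p r s k → cong (λ t → coeff t k) (++-assoc p r s)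
                }
              ; identity = (λ _ _ → refl) , (λ p k → cong (λ t → coeff t k) (++-identityʳ p))
              }
            ; inverse = -‿inverseˡ , (λ p k → trans (+-comm p (- p) k) (-‿inverseˡ p k))
            ; ⁻¹-cong = λ {p} {r} → -‿cong {p} {r}
            }
          ; comm = +-comm
          }
        ; *-cong = λ {p} {p′} {r} {r′} → *-cong {p} {p′} {r} {r′}
        ; *-assoc = *-assoc
        ; *-identity = *-identityˡ , (λ p k → trans (*-comm p 1# k) (*-identityˡ p k))
        ; distrib =
            (λ s p r k → trans (*-comm s (p + r) k) (trans (*-distribʳ-+ s p r k)
              (+-cong {p * s} {s * p} {r * s} {s * r} (*-comm p s) (*-comm r s) k)))
          , *-distribʳ-+
        }
      ; *-comm = *-comm
      }
    }
    where
    ≈-isEquivalence : IsEquivalence _≈_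
    ≈-isEquivalence = record
      { refl  = λ _ → refl
      ; sym   = λ p≈r k → sym (p≈r k)
      ; trans = λ p≈r r≈s k → trans (p≈r k) (r≈s k)
      }

-- Power series, their truncations, and the substitution q ↦ -q

module SeriesRing {c ℓ} (R : CommutativeRing c ℓ) where
  private
    module R where
      open CommutativeRing R public
      open FiniteSums R public
      open IntegerSolver R public
      open Algebra.Properties.Semiring.Exp semiring public using (_^_; ^-homo-*)
  open PowerSeries (Algebra.Bundles.Ring.rawRing R.ring)
  open Relation.Binary.Reasoning.Setoid R.setoid

  convolution : Series → Series → Series
  convolution f g n = R.∑< (suc n) (λ i → f i R.* g (n ∸ i))

  *-convolution : ∀ f g n → (f * g) n R.≈ convolution f g n
  *-convolution f g n = R.reflexive (R.sum-∑< (suc n) (λ i → f i R.* g (n ∸ i)))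

  convolution-cong : ∀ n {f f′ g g′} → (∀ i → i ≤ n → f i R.≈ f′ i) → (∀ i → i ≤ n → g i R.≈ g′ i) →
                     convolution f g n R.≈ convolution f′ g′ n
  convolution-cong n f≈ g≈ = R.∑<-cong (suc n)
    (λ i i≤n → R.*-cong (f≈ i (ℕ.≤-pred i≤n)) (g≈ (n ∸ i) (ℕ.m∸n≤m n i)))

  -- Peels off the last term, whereas unfolding the definition peels off the first. With the factors
  -- exchanged the two recursions match, which proves commutativity.
  convolution-sucʳ : ∀ f g n →
    convolution f g (suc n) R.≈ f (suc n) R.* g 0 R.+ convolution f (g ∘ suc) n
  convolution-sucʳ f g zero    =
    R.solve 4 (λ a b c d → a R.:* d R.:+ (b R.:* c R.:+ R.𝟘) R.:= b R.:* c R.:+ (a R.:* d R.:+ R.𝟘))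
      R.refl (f 0) (f 1) (g 0) (g 1)
  convolution-sucʳ f g (suc n) = R.trans
    (R.+-congˡ (convolution-sucʳ (f ∘ suc) g n))
    (R.solve 3 (λ a b c → a R.:+ (b R.:+ c) R.:= b R.:+ (a R.:+ c)) R.refl
      (f 0 R.* g (suc (suc n))) (f (suc (suc n)) R.* g 0) (convolution (f ∘ suc) (g ∘ suc) n))

  convolution-comm : ∀ f g n → convolution f g n R.≈ convolution g f n
  convolution-comm f g zero    = R.+-congʳ (R.*-comm _ _)
  convolution-comm f g (suc n) = begin
    f 0 R.* g (suc n) R.+ convolution (f ∘ suc) g n
      ≈⟨ R.+-cong (R.*-comm _ _) (convolution-comm (f ∘ suc) g n) ⟩
    g (suc n) R.* f 0 R.+ convolution g (f ∘ suc) n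
      ≈⟨ convolution-sucʳ g f n ⟨
    convolution g f (suc n) ∎

  convolution-+ˡ : ∀ f g h n →
    convolution (f + g) h n R.≈ convolution f h n R.+ convolution g h n
  convolution-+ˡ f g h n = R.trans
    (R.∑<-cong (suc n) (λ i _ → R.distribʳ (h (n ∸ i)) (f i) (g i)))
    (R.∑<-+ (suc n) (λ i → f i R.* h (n ∸ i)) (λ i → g i R.* h (n ∸ i)))

  convolution-scale : ∀ a f g n → convolution (λ i → a R.* f i) g n R.≈ a R.* convolution f g n
  convolution-scale a f g n = R.trans
    (R.∑<-cong (suc n) (λ i _ → R.*-assoc a (f i) (g (n ∸ i))))
    (R.sym (R.*-distribˡ-∑< (suc n) a (λ i → f i R.* g (n ∸ i))))

  convolution-assoc : ∀ f g h n →
    convolution (convolution f g) h n R.≈ convolution f (convolution g h) n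
  convolution-assoc f g h zero    = R.solve 3
    (λ a b c → (a R.:* b R.:+ R.𝟘) R.:* c R.:+ R.𝟘 R.:= a R.:* (b R.:* c R.:+ R.𝟘) R.:+ R.𝟘)
    R.refl (f 0) (g 0) (h 0)
  convolution-assoc f g h (suc n) = begin
    (f 0 R.* g 0 R.+ R.0#) R.* h (suc n)
      -- The shift of `convolution f g` by one unfolds to this pointwise sum, to which additivity
      -- and the induction hypothesis apply.
      R.+ convolution ((λ i → f 0 R.* g (suc i)) + convolution (f ∘ suc) g) h n
      ≈⟨ R.+-congˡ (R.trans (convolution-+ˡ (λ i → f 0 R.* g (suc i)) (convolution (f ∘ suc) g) h n)
           (R.+-cong (convolution-scale (f 0) (g ∘ suc) h n) (convolution-assoc (f ∘ suc) g h n))) ⟩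
    (f 0 R.* g 0 R.+ R.0#) R.* h (suc n)
      R.+ (f 0 R.* convolution (g ∘ suc) h n R.+ convolution (f ∘ suc) (convolution g h) n)
      ≈⟨ R.solve 5 (λ a b c x y → (a R.:* b R.:+ R.𝟘) R.:* c R.:+ (a R.:* x R.:+ y)
           R.:= a R.:* (b R.:* c R.:+ x) R.:+ y) R.refl (f 0) (g 0) (h (suc n))
           (convolution (g ∘ suc) h n) (convolution (f ∘ suc) (convolution g h) n) ⟩
    convolution f (convolution g h) (suc n) ∎

  q^0-convolution : ∀ a f n → convolution (a q^ 0) f n R.≈ a R.* f n
  q^0-convolution a f zero    = R.+-identityʳ _
  q^0-convolution a f (suc n) = R.trans
    (R.+-congˡ (R.∑<-zero (suc n) {λ i → R.0# R.* f (n ∸ i)} (λ i _ → R.zeroˡ _)))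
    (R.+-identityʳ _)

  infix 4 _≈[_]_
  _≈[_]_ : Series → ℕ → Series → Set ℓ
  f ≈[ N ] g = ∀ n → n ≤ N → f n R.≈ g n

  *-cong-≤ : ∀ {N f f′ g g′} → f ≈[ N ] f′ → g ≈[ N ] g′ → f * g ≈[ N ] f′ * g′
  *-cong-≤ {N} {f} {f′} {g} {g′} f≈ g≈ n n≤N = begin
    (f * g) n             ≈⟨ *-convolution f g n ⟩
    convolution f g n     ≈⟨ convolution-cong n (λ i i≤n → f≈ i (ℕ.≤-trans i≤n n≤N))
                                                (λ i i≤n → g≈ i (ℕ.≤-trans i≤n n≤N)) ⟩
    convolution f′ g′ n   ≈⟨ *-convolution f′ g′ n ⟨
    (f′ * g′) n           ∎

  *-commutative : ∀ f g n → (f * g) n R.≈ (g * f) n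
  *-commutative f g n = begin
    (f * g) n         ≈⟨ *-convolution f g n ⟩
    convolution f g n ≈⟨ convolution-comm f g n ⟩
    convolution g f n ≈⟨ *-convolution g f n ⟨
    (g * f) n         ∎

  *-associative : ∀ f g h n → ((f * g) * h) n R.≈ (f * (g * h)) n
  *-associative f g h n = begin
    ((f * g) * h) n                    ≈⟨ *-convolution (f * g) h n ⟩
    convolution (f * g) h n
      ≈⟨ convolution-cong n {g = h} {g′ = h} (λ i _ → *-convolution f g i) (λ _ _ → R.refl) ⟩
    convolution (convolution f g) h n  ≈⟨ convolution-assoc f g h n ⟩
    convolution f (convolution g h) n
      ≈⟨ convolution-cong n {f} {f} (λ _ _ → R.refl) (λ i _ → *-convolution g h i) ⟨
    convolution f (g * h) n            ≈⟨ *-convolution f (g * h) n ⟨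
    (f * (g * h)) n                    ∎

  *-identityˡ : ∀ f n → (1# * f) n R.≈ f n
  *-identityˡ f n = R.trans (*-convolution 1# f n)
    (R.trans (q^0-convolution R.1# f n) (R.*-identityˡ (f n)))

  *-distribʳ : ∀ h f g n → ((f + g) * h) n R.≈ (f * h + g * h) n
  *-distribʳ h f g n = begin
    ((f + g) * h) n                              ≈⟨ *-convolution (f + g) h n ⟩
    convolution (f + g) h n                      ≈⟨ convolution-+ˡ f g h n ⟩
    convolution f h n R.+ convolution g h n
      ≈⟨ R.+-cong (*-convolution f h n) (*-convolution g h n) ⟨
    (f * h + g * h) n                            ∎

  -- R[[q]]/(q^(N+1))
  truncated : ℕ → CommutativeRing c ℓ
  truncated N = record
    { Carrier = Series
    ; _≈_ = _≈[ N ]_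
    ; _+_ = _+_
    ; _*_ = _*_
    ; -_  = -_
    ; 0#  = 0#
    ; 1#  = 1#
    ; isCommutativeRing = record
      { isRing = record
        { +-isAbelianGroup = record
          { isGroup = record
            { isMonoid = record
              { isSemigroup = record
                { isMagma = record
                  { isEquivalence = record
                    { refl  = λ _ _ → R.refl
                    ; sym   = λ f≈g n n≤N → R.sym (f≈g n n≤N)
                    ; trans = λ f≈g g≈h n n≤N → R.trans (f≈g n n≤N) (g≈h n n≤N)
                    }
                  ; ∙-cong = λ f≈ g≈ n n≤N → R.+-cong (f≈ n n≤N) (g≈ n n≤N)
                  }
                ; assoc = λ _ _ _ _ _ → R.+-assoc _ _ _
                }
              ; identity = (λ _ _ _ → R.+-identityˡ _) , (λ _ _ _ → R.+-identityʳ _)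
              }
            ; inverse = (λ _ _ _ → R.-‿inverseˡ _) , (λ _ _ _ → R.-‿inverseʳ _)
            ; ⁻¹-cong = λ f≈g n n≤N → R.-‿cong (f≈g n n≤N)
            }
          ; comm = λ _ _ _ _ → R.+-comm _ _
          }
        ; *-cong = λ {f} {f′} {g} {g′} → *-cong-≤ {N} {f} {f′} {g} {g′}
        ; *-assoc = λ f g h n _ → *-associative f g h n
        ; *-identity = (λ f n _ → *-identityˡ f n)
                     , (λ f n _ → R.trans (*-commutative f 1# n) (*-identityˡ f n))
        ; distrib = (λ h f g n _ → R.trans (*-commutative h (f + g) n)
                      (R.trans (*-distribʳ h f g n)
                        (R.+-cong (*-commutative f h n) (*-commutative g h n))))
                  , (λ h f g n _ → *-distribʳ h f g n)
        }
      ; *-comm = λ f g n _ → *-commutative f g n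
      }
    }

  private module S (N : ℕ) where
    open CommutativeRing (truncated N) public using (refl; trans; *-cong; *-identityʳ)
    open FiniteSums (truncated N) public

  q : Series
  q = R.1# q^ 1

  q^-* : ∀ a b m n k → ((a q^ m) * (b q^ n)) k R.≈ ((a R.* b) q^ (m ℕ.+ n)) k
  q^-* a b m n k = R.trans (*-convolution (a q^ m) (b q^ n) k) (go m k)
    where
    scale : ∀ n k → a R.* (b q^ n) k R.≈ ((a R.* b) q^ n) k
    scale zero    zero    = R.refl
    scale zero    (suc k) = R.zeroʳ a
    scale (suc n) zero    = R.zeroʳ a
    scale (suc n) (suc k) = scale n k
    go : ∀ m k → convolution (a q^ m) (b q^ n) k R.≈ ((a R.* b) q^ (m ℕ.+ n)) k
    go zero    k       = R.trans (q^0-convolution a (b q^ n) k) (scale n k)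
    go (suc m) zero    = R.trans (R.+-identityʳ _) (R.zeroˡ _)
    go (suc m) (suc k) = R.trans (R.+-cong (R.zeroˡ _) (go m k)) (R.+-identityˡ _)

  q^-cong : ∀ {a b} n → a R.≈ b → ∀ k → (a q^ n) k R.≈ (b q^ n) k
  q^-cong zero    a≈b zero    = a≈b
  q^-cong zero    a≈b (suc k) = R.refl
  q^-cong (suc n) a≈b zero    = R.refl
  q^-cong (suc n) a≈b (suc k) = q^-cong n a≈b k

  q^-> : ∀ a {n k} → k < n → (a q^ n) k R.≈ R.0#
  q^-> a {suc n} {zero}  _         = R.refl
  q^-> a {suc n} {suc k} (s≤s k<n) = q^-> a {n} {k} k<n

  power-of-q : ∀ n k → (q ^ n) k R.≈ (R.1# q^ n) k
  power-of-q zero    k = R.refl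
  power-of-q (suc n) k = begin
    (q * q ^ n) k
      ≈⟨ *-cong-≤ {k} {q} {q} {q ^ n} {R.1# q^ n} (λ _ _ → R.refl) (λ j _ → power-of-q n j) k ℕ.≤-refl ⟩
    (q * (R.1# q^ n)) k           ≈⟨ q^-* R.1# R.1# 1 n k ⟩
    ((R.1# R.* R.1#) q^ suc n) k  ≈⟨ q^-cong (suc n) (R.*-identityˡ R.1#) k ⟩
    (R.1# q^ suc n) k             ∎

  ∑≤-coefficient : ∀ n (t : ℕ → Series) k → ∑≤ n t k ≡ R.∑< (suc n) (λ j → t j k)
  ∑≤-coefficient zero    t k = ≡.refl
  ∑≤-coefficient (suc n) t k = ≡.cong (λ x → t 0 k R.+ x) (∑≤-coefficient n (t ∘ suc) k)

  ∑≤-∑< : ∀ N n t → ∑≤ n t ≡ S.∑< N (suc n) t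
  ∑≤-∑< N n t = S.sum-∑< N (suc n) t

  ∑∞-truncated : ∀ N t → (∀ j n → n < j → t j n R.≈ R.0#) → ∑∞ t ≈[ N ] S.∑< N (suc N) t
  ∑∞-truncated N t t≈0 n n≤N = begin
    ∑≤ n t n                            ≡⟨ ∑≤-coefficient n t n ⟩
    R.∑< (suc n) (λ j → t j n)          ≈⟨ R.∑<-extend (N ∸ n) (suc n) (λ j → t j n) (λ j n<j → t≈0 j n n<j) ⟨
    R.∑< (suc n ℕ.+ (N ∸ n)) (λ j → t j n)
      ≡⟨ ≡.cong (λ m → R.∑< (suc m) (λ j → t j n)) (ℕ.m+[n∸m]≡n n≤N) ⟩
    R.∑< (suc N) (λ j → t j n)          ≡⟨ ∑≤-coefficient N t n ⟨
    ∑≤ N t n                            ≡⟨ ≡.cong (λ f → f n) (∑≤-∑< N N t) ⟩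
    S.∑< N (suc N) t n                  ∎

  ∏∞-truncated : ∀ N t → (∀ j n → n < j → t j ≈[ n ] 1#) → ∏∞ t ≈[ N ] S.∏< N (suc N) t
  ∏∞-truncated N t t≈1 n n≤N = begin
    ∏≤ n t n                            ≡⟨ ≡.cong (λ f → f n) (S.product-∏< n (suc n) t) ⟩
    -- The comparison is made modulo qⁿ⁺¹, where the factors beyond the n-th are 1. All truncations
    -- share their operations, so a finite product is the same series in each of them.
    S.∏< n (suc n) t n                  ≈⟨ extend (N ∸ n) n ℕ.≤-refl ⟨
    S.∏< n (suc (N ∸ n) ℕ.+ n) t n
      ≡⟨ ≡.cong (λ m → S.∏< n (suc m) t n) (ℕ.m∸n+n≡m n≤N) ⟩
    S.∏< n (suc N) t n                  ≡⟨ ≡.cong (λ f → f n) (S.product-∏< n (suc N) t) ⟨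
    ∏≤ N t n                            ≡⟨ ≡.cong (λ f → f n) (S.product-∏< N (suc N) t) ⟩
    S.∏< N (suc N) t n                  ∎
    where
    extend : ∀ d → S.∏< n (suc d ℕ.+ n) t ≈[ n ] S.∏< n (suc n) t
    extend zero    = S.refl n
    extend (suc d) = S.trans n (S.∏<-last n (suc d ℕ.+ n) t) (S.trans n
      (S.*-cong n (extend d) (t≈1 (suc d ℕ.+ n) n (s≤s (ℕ.m≤n+m n d))))
      (S.*-identityʳ n (S.∏< n (suc n) t)))

  powers-vanish : ∀ x → x 0 R.≈ R.0# → ∀ k n → n < k → (x ^ k) n R.≈ R.0#
  powers-vanish x x₀≈0 (suc k) n (s≤s n≤k) = begin
    (x * x ^ k) n               ≈⟨ *-convolution x (x ^ k) n ⟩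
    x 0 R.* (x ^ k) n R.+ R.∑< n (λ i → x (suc i) R.* (x ^ k) (n ∸ suc i))
      ≈⟨ R.+-cong (R.trans (R.*-congʳ x₀≈0) (R.zeroˡ _)) (R.∑<-zero n (λ i i<n → R.trans
           (R.*-congˡ (powers-vanish x x₀≈0 k (n ∸ suc i)
             (ℕ.<-≤-trans (ℕ.∸-monoʳ-< (ℕ.z<s {i}) i<n) n≤k))) (R.zeroʳ _))) ⟩
    R.0# R.+ R.0#               ≈⟨ R.+-identityˡ R.0# ⟩
    R.0#                        ∎

  product-vanishes : ∀ f g {m} → (∀ n → n < m → g n R.≈ R.0#) → ∀ n → n < m → (f * g) n R.≈ R.0#
  product-vanishes f g g≈0 n n<m = R.trans (*-convolution f g n)
    (R.∑<-zero (suc n) {λ i → f i R.* g (n ∸ i)} (λ i _ → R.trans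
      (R.*-congˡ (g≈0 (n ∸ i) (ℕ.≤-<-trans (ℕ.m∸n≤m n i) n<m))) (R.zeroʳ (f i))))

  private
    -1^-split : ∀ i n → i ≤ n → (R.- R.1#) R.^ n R.≈ (R.- R.1#) R.^ i R.* (R.- R.1#) R.^ (n ∸ i)
    -1^-split i n i≤n = R.trans (R.reflexive (≡.cong ((R.- R.1#) R.^_) (≡.sym (ℕ.m+[n∸m]≡n i≤n))))
      (R.^-homo-* (R.- R.1#) i (n ∸ i))

  [-q]-* : ∀ f g n → ((f * g) [-q]) n R.≈ (f [-q] * g [-q]) n
  [-q]-* f g n = begin
    ε n R.* (f * g) n
      ≈⟨ R.*-congˡ (*-convolution f g n) ⟩
    ε n R.* convolution f g n
      ≈⟨ R.*-distribˡ-∑< (suc n) (ε n) (λ i → f i R.* g (n ∸ i)) ⟩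
    R.∑< (suc n) (λ i → ε n R.* (f i R.* g (n ∸ i)))
      ≈⟨ R.∑<-cong (suc n) (λ i i≤n → R.trans
           (R.*-congʳ (-1^-split i n (ℕ.≤-pred i≤n)))
           (R.solve 4 (λ a b c d → a R.:* b R.:* (c R.:* d) R.:= a R.:* c R.:* (b R.:* d)) R.refl
             (ε i) (ε (n ∸ i)) (f i) (g (n ∸ i)))) ⟩
    convolution (f [-q]) (g [-q]) n
      ≈⟨ *-convolution (f [-q]) (g [-q]) n ⟨
    (f [-q] * g [-q]) n ∎
    where ε = (R.- R.1#) R.^_

  [-q]-+ : ∀ f g n → ((f + g) [-q]) n R.≈ (f [-q] + g [-q]) n
  [-q]-+ f g n = R.distribˡ _ (f n) (g n)

  [-q]-neg : ∀ f n → ((- f) [-q]) n R.≈ (- (f [-q])) n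
  [-q]-neg f n = R.solve 2 (λ a b → a R.:* R.:- b R.:= R.:- (a R.:* b)) R.refl _ (f n)

  [-q]-q^ : ∀ a m n → ((a q^ m) [-q]) n R.≈ (((R.- R.1#) R.^ m R.* a) q^ m) n
  [-q]-q^ a m n = go m n ((R.- R.1#) R.^_)
    where
    -- The induction shifts the signs along with the indices, hence an arbitrary sequence instead of
    -- (-1)ⁿ.
    go : ∀ m n (ε : ℕ → R.Carrier) → ε n R.* (a q^ m) n R.≈ ((ε m R.* a) q^ m) n
    go zero    zero    ε = R.refl
    go zero    (suc n) ε = R.zeroʳ _
    go (suc m) zero    ε = R.zeroʳ _
    go (suc m) (suc n) ε = go m n (ε ∘ suc)

-- Both sides of the theorem modulo qᴺ⁺¹

module TruncatedSeries {c ℓ} (R : CommutativeRing c ℓ) (N : ℕ) where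
  private module R = CommutativeRing R
  open SeriesRing R hiding (*-identityˡ; *-distribʳ)
  open CommutativeRing (truncated N)
  open PowerSeries (Algebra.Bundles.Ring.rawRing R.ring)
    using (Series; _q^_; ∑∞; ∏∞; _⁻¹; _/_; [_⨾q²]∞; _[-q]; ∑≤) renaming (_^_ to _^ₛ_)
  open Algebra.Properties.Semiring.Exp semiring using (_^_)
  open IntegerSolver (truncated N)
  open FiniteSums (truncated N)
  open HeckeRogers (truncated N) q using (p; p^≈q^)
  open Relation.Binary.Reasoning.Setoid setoid

  -- The two powers are those of raw semirings with different equalities.
  ^ₛ-^ : ∀ f n → f ^ₛ n ≡ f ^ n
  ^ₛ-^ f zero    = ≡.refl
  ^ₛ-^ f (suc n) = ≡.cong (f *_) (^ₛ-^ f n)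

  q^≈1q^ : ∀ n → q ^ n ≈ R.1# q^ n
  q^≈1q^ n = trans (reflexive (≡.sym (^ₛ-^ q n))) (λ k _ → power-of-q n k)

  q^-≥ : ∀ a → suc N ≤ a → q ^ a ≈ 0#
  q^-≥ a N<a n n≤N = R.trans (q^≈1q^ a n n≤N) (q^-> R.1# (ℕ.<-≤-trans (s≤s n≤N) N<a))

  open Pochhammer (truncated N) q using (module Truncated)
  open Truncated (suc N) q^-≥ public

  -- Multiplication by f = 1 - x collapses the geometric sum to 1 - xᴺ⁺¹, and x has constant
  -- coefficient 0.
  ⁻¹-inverse : ∀ f → f 0 R.≈ R.1# → f * f ⁻¹ ≈ 1#
  ⁻¹-inverse f f₀≈1 = begin
    f * f ⁻¹                      ≈⟨ *-congˡ {f} (∑∞-truncated N (x ^ₛ_) (powers-vanish x x₀≈0)) ⟩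
    f * ∑< (suc N) (x ^ₛ_)        ≈⟨ *-congˡ {f} (∑<-cong (suc N) (λ k _ → reflexive (^ₛ-^ x k))) ⟩
    f * ∑< (suc N) (x ^_)         ≈⟨ geometric (suc N) ⟩
    1# - x ^ suc N                ≈⟨ +-congˡ {1#} (-‿cong x^[1+N]≈0) ⟩
    1# - 0#                       ≈⟨ solve 0 (𝟙 :- 𝟘 := 𝟙) refl ⟩
    1#                            ∎
    where
    x = 1# - f
    x₀≈0 : x 0 R.≈ R.0#
    x₀≈0 = R.trans (R.+-congˡ (R.-‿cong f₀≈1)) (R.-‿inverseʳ R.1#)
    x^[1+N]≈0 : x ^ suc N ≈ 0#
    x^[1+N]≈0 = trans (reflexive (≡.sym (^ₛ-^ x (suc N))))
      (λ n n≤N → powers-vanish x x₀≈0 (suc N) n (s≤s n≤N))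
    geometric : ∀ M → f * ∑< M (x ^_) ≈ 1# - x ^ M
    geometric zero    = solve 1 (λ f → f :* 𝟘 := 𝟙 :- 𝟙) refl f
    geometric (suc M) = begin
      f * ∑< (suc M) (x ^_)             ≈⟨ *-congˡ {f} (∑<-last M (x ^_)) ⟩
      f * (∑< M (x ^_) + x ^ M)         ≈⟨ distribˡ f (∑< M (x ^_)) (x ^ M) ⟩
      f * ∑< M (x ^_) + f * x ^ M       ≈⟨ +-congʳ {f * x ^ M} (geometric M) ⟩
      (1# - x ^ M) + f * x ^ M
        ≈⟨ solve 2 (λ f y → (𝟙 :- y) :+ f :* y := 𝟙 :- (𝟙 :- f) :* y) refl f (x ^ M) ⟩
      1# - x ^ suc M                    ∎

  1q^≈p^ : ∀ k → R.1# q^ (2 ℕ.* k) ≈ p ^ k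
  1q^≈p^ k = begin
    R.1# q^ (2 ℕ.* k)      ≈⟨ q^≈1q^ (2 ℕ.* k) ⟨
    q ^ (2 ℕ.* k)          ≡⟨ ≡.cong (λ m → q ^ (k ℕ.+ m)) (ℕ.+-identityʳ k) ⟩
    q ^ (k ℕ.+ k)          ≈⟨ p^≈q^ k ⟨
    p ^ k                  ∎

  ⨾q²-poch : ∀ a → [ a ⨾q²]∞ ≈ poch a
  ⨾q²-poch a = begin
    ∏∞ t               ≈⟨ ∏∞-truncated N t t≈1 ⟩
    ∏< (suc N) t       ≈⟨ ∏<-cong (suc N) (λ k _ → +-congˡ {1#} (-‿cong (*-congˡ {a} (1q^≈p^ k)))) ⟩
    poch a             ∎
    where
    t : ℕ → Series
    t k = 1# - a * (R.1# q^ (2 ℕ.* k))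
    t≈1 : ∀ j n → n < j → t j ≈[ n ] 1#
    t≈1 j n n<j k k≤n = R.trans (R.+-congˡ (R.trans (R.-‿cong
        (product-vanishes a (R.1# q^ (2 ℕ.* j)) (λ _ → q^-> R.1#) k
          (ℕ.<-≤-trans (ℕ.≤-<-trans k≤n n<j) (ℕ.m≤m+n j (j ℕ.+ 0))))) -0≈0))
      (R.+-identityʳ _)
      where
      open Algebra.Properties.AbelianGroup R.+-abelianGroup renaming (ε⁻¹≈ε to -0≈0)

  [-q]-cong : ∀ {f g} → f ≈ g → f [-q] ≈ g [-q]
  [-q]-cong f≈g n n≤N = R.*-congˡ (f≈g n n≤N)

  [-q]-constant : ∀ a → (a q^ 0) [-q] ≈ a q^ 0
  [-q]-constant a n _ = R.trans ([-q]-q^ a 0 n) (q^-cong 0 (R.*-identityˡ a) n)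

  [-q]-homo : ∀ f g → (f * g) [-q] ≈ f [-q] * g [-q]
  [-q]-homo f g n _ = [-q]-* f g n

  [-q]-p^ : ∀ k → (p ^ k) [-q] ≈ p ^ k
  [-q]-p^ zero    = [-q]-constant R.1#
  [-q]-p^ (suc k) = begin
    (p * p ^ k) [-q]              ≈⟨ [-q]-homo p (p ^ k) ⟩
    p [-q] * (p ^ k) [-q]         ≈⟨ *-cong {p [-q]} {p} {(p ^ k) [-q]} {p ^ k} [-q]-p ([-q]-p^ k) ⟩
    p * p ^ k                     ∎
    where
    open IntegerSolver R using () renaming (solve to solveᴿ; _:*_ to _·_; :-_ to −_; 𝟙 to I; _:=_ to _≐_)
    [-q]-p : p [-q] ≈ p
    [-q]-p = begin
      p [-q]               ≈⟨ [-q]-cong p≈ ⟩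
      (R.1# q^ 2) [-q]     ≈⟨ (λ n _ → [-q]-q^ R.1# 2 n) ⟩
      ((R.- R.1# R.* (R.- R.1# R.* R.1#)) R.* R.1#) q^ 2
        ≈⟨ (λ n _ → q^-cong 2 (solveᴿ 0 ((− I · (− I · I)) · I ≐ I) R.refl) n) ⟩
      R.1# q^ 2            ≈⟨ p≈ ⟨
      p                    ∎
      where
      p≈ : p ≈ R.1# q^ 2
      p≈ n _ = R.trans (q^-* R.1# R.1# 1 1 n) (q^-cong 2 (R.*-identityˡ R.1#) n)

  [-q]-q : q [-q] ≈ - q
  [-q]-q n _ = R.trans ([-q]-q^ R.1# 1 n) (helper n)
    where
    open Algebra.Properties.Ring R.ring using (-0#≈0#)
    helper : ∀ n → (((R.- R.1# R.* R.1#) R.* R.1#) q^ 1) n R.≈ (- q) n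
    helper zero          = R.sym -0#≈0#
    helper (suc zero)    = R.trans (R.*-identityʳ _) (R.*-identityʳ _)
    helper (suc (suc n)) = R.sym -0#≈0#

  [-q]-poch : ∀ a → poch a [-q] ≈ poch (a [-q])
  [-q]-poch a = go (suc N)
    where
    go : ∀ n → ∏< n (λ k → 1# - a * p ^ k) [-q] ≈ ∏< n (λ k → 1# - a [-q] * p ^ k)
    go zero    = [-q]-constant R.1#
    go (suc n) = begin
      ∏< (suc n) f [-q]            ≈⟨ [-q]-cong (∏<-last n f) ⟩
      (∏< n f * f n) [-q]          ≈⟨ [-q]-homo (∏< n f) (f n) ⟩
      ∏< n f [-q] * f n [-q]       ≈⟨ *-cong {∏< n f [-q]} {∏< n g} {f n [-q]} {g n} (go n) factor ⟩
      ∏< n g * g n                 ≈⟨ ∏<-last n g ⟨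
      ∏< (suc n) g                 ∎
      where
      f = λ k → 1# - a * p ^ k
      g = λ k → 1# - a [-q] * p ^ k
      factor : f n [-q] ≈ g n
      factor = begin
        (1# - a * p ^ n) [-q]              ≈⟨ (λ m _ → [-q]-+ 1# (- (a * p ^ n)) m) ⟩
        1# [-q] + (- (a * p ^ n)) [-q]
          ≈⟨ +-cong {1# [-q]} {1#} ([-q]-constant R.1#) (λ m _ → [-q]-neg (a * p ^ n) m) ⟩
        1# - (a * p ^ n) [-q]
          ≈⟨ +-congˡ {1#} (-‿cong (trans ([-q]-homo a (p ^ n)) (*-congˡ {a [-q]} ([-q]-p^ n)))) ⟩
        1# - a [-q] * p ^ n                ∎

  [-q]-⨾q² : ∀ a → [ a ⨾q²]∞ [-q] ≈ poch (a [-q])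
  [-q]-⨾q² a = trans ([-q]-cong (⨾q²-poch a)) ([-q]-poch a)

  [-q]-∑< : ∀ n t → ∑< n t [-q] ≈ ∑< n (λ k → t k [-q])
  [-q]-∑< zero    t = λ _ _ → R.zeroʳ _
  [-q]-∑< (suc n) t = trans (λ m _ → [-q]-+ (t 0) (∑< n (t ∘ suc)) m)
    (+-congˡ {t 0 [-q]} ([-q]-∑< n (t ∘ suc)))

  -- By the definition of `∏∞` the constant coefficient is read off the factor k = 0 alone.
  ⨾q²-constant : ∀ a → a 0 R.≈ R.0# → [ a ⨾q²]∞ 0 R.≈ R.1#
  ⨾q²-constant a a₀≈0 = R.trans
    (R.+-congʳ (R.*-congʳ (R.+-congˡ (R.-‿cong (R.+-congʳ (R.*-congʳ a₀≈0))))))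
    (solveᴿ 0 ((I ∔ − (O · I ∔ O)) · I ∔ O ≐ I) R.refl)
    where
    open IntegerSolver R using ()
      renaming (solve to solveᴿ; _:*_ to _·_; _:+_ to _∔_; :-_ to −_; 𝟙 to I; 𝟘 to O; _:=_ to _≐_)

  module _ (ζ ζ⁻¹ : R.Carrier) (ζζ⁻¹≈1 : ζ R.* ζ⁻¹ R.≈ R.1#) where

    private
      z z⁻¹ : Series
      z   = ζ q^ 0
      z⁻¹ = ζ⁻¹ q^ 0

      zz⁻¹≈1 : z * z⁻¹ ≈ 1#
      zz⁻¹≈1 n _ = R.trans (q^-* ζ ζ⁻¹ 0 0 n) (q^-cong 0 ζζ⁻¹≈1 n)

      P₀⁻¹ : Series
      P₀⁻¹ = [ p ⨾q²]∞ ⁻¹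

      P₀*P₀⁻¹≈1 : poch p * P₀⁻¹ ≈ 1#
      P₀*P₀⁻¹≈1 = begin
        poch p * P₀⁻¹             ≈⟨ *-congʳ {P₀⁻¹} (⨾q²-poch p) ⟨
        [ p ⨾q²]∞ * P₀⁻¹
          ≈⟨ ⁻¹-inverse [ p ⨾q²]∞ (⨾q²-constant p (R.trans (R.+-identityʳ _) (R.zeroˡ _))) ⟩
        1#                        ∎

    open SptCrank z z⁻¹ zz⁻¹≈1 P₀⁻¹ P₀*P₀⁻¹≈1

    numerator divisor term : ℕ → Series
    numerator n = R.1# q^ (2 ℕ.* n) * [ R.1# q^ (2 ℕ.* n ℕ.+ 2) ⨾q²]∞ * [ - (R.1# q^ (2 ℕ.* n ℕ.+ 1)) ⨾q²]∞
    divisor n   = [ z * (R.1# q^ (2 ℕ.* n)) ⨾q²]∞ * [ z⁻¹ * (R.1# q^ (2 ℕ.* n)) ⨾q²]∞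
    term n      = numerator n / divisor n

    divisor-constant : ∀ ν → divisor (suc ν) 0 R.≈ R.1#
    divisor-constant ν = R.trans
      (R.+-cong (R.*-cong (⨾q²-constant (z * x) (vanish ζ)) (⨾q²-constant (z⁻¹ * x) (vanish ζ⁻¹))) R.refl)
      (R.trans (R.+-identityʳ _) (R.*-identityˡ _))
      where
      x = R.1# q^ (2 ℕ.* suc ν)
      vanish : ∀ a → a R.* R.0# R.+ R.0# R.≈ R.0#
      vanish a = R.trans (R.+-identityʳ _) (R.zeroʳ a)

    divisor*term : ∀ ν → let n = suc ν in divisor n * term n ≈ numerator n
    divisor*term ν = begin
      d * (e * d ⁻¹)
        ≈⟨ solve 3 (λ d e d⁻¹ → d :* (e :* d⁻¹) := e :* (d :* d⁻¹)) refl d e (d ⁻¹) ⟩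
      e * (d * d ⁻¹)     ≈⟨ *-congˡ {e} (⁻¹-inverse d (divisor-constant ν)) ⟩
      e * 1#             ≈⟨ *-identityʳ e ⟩
      e                  ∎
      where d = divisor (suc ν)
            e = numerator (suc ν)

    [-q]-divisor : ∀ n → divisor n [-q] ≈ denominator n
    [-q]-divisor n = begin
      divisor n [-q]
        ≈⟨ [-q]-homo [ z * x ⨾q²]∞ [ z⁻¹ * x ⨾q²]∞ ⟩
      [ z * x ⨾q²]∞ [-q] * [ z⁻¹ * x ⨾q²]∞ [-q]
        ≈⟨ *-cong {[ z * x ⨾q²]∞ [-q]} {poch (z * p ^ n)} {[ z⁻¹ * x ⨾q²]∞ [-q]} {poch (z⁻¹ * p ^ n)}
             (factor ζ) (factor ζ⁻¹) ⟩
      denominator n ∎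
      where
      x = R.1# q^ (2 ℕ.* n)
      factor : ∀ a → [ (a q^ 0) * x ⨾q²]∞ [-q] ≈ poch ((a q^ 0) * p ^ n)
      factor a = begin
        [ (a q^ 0) * x ⨾q²]∞ [-q]           ≈⟨ [-q]-⨾q² ((a q^ 0) * x) ⟩
        poch (((a q^ 0) * x) [-q])          ≈⟨ poch-cong {((a q^ 0) * x) [-q]} {(a q^ 0) * p ^ n} (begin
          ((a q^ 0) * x) [-q]                 ≈⟨ [-q]-homo (a q^ 0) x ⟩
          (a q^ 0) [-q] * x [-q]
            ≈⟨ *-cong {(a q^ 0) [-q]} {a q^ 0} {x [-q]} {p ^ n} ([-q]-constant a) (begin
                 x [-q]             ≈⟨ [-q]-cong (1q^≈p^ n) ⟩
                 (p ^ n) [-q]       ≈⟨ [-q]-p^ n ⟩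
                 p ^ n              ∎) ⟩
          (a q^ 0) * p ^ n                    ∎) ⟩
        poch ((a q^ 0) * p ^ n)             ∎

    -- Even powers of q are fixed, while -q²ⁿ⁺¹ turns into q²ⁿ⁺¹. The two infinite products then
    -- interleave to (q²ⁿ⁺¹;q)_∞, which is why the theorem is about S2(z,-q).
    [-q]-numerator : ∀ n → numerator n [-q] ≈ p ^ n * poch (p ^ suc n) * poch (q * p ^ n)
    [-q]-numerator n = begin
      (x * [ y ⨾q²]∞ * [ - w ⨾q²]∞) [-q]
        ≈⟨ [-q]-homo (x * [ y ⨾q²]∞) [ - w ⨾q²]∞ ⟩
      (x * [ y ⨾q²]∞) [-q] * [ - w ⨾q²]∞ [-q]
        ≈⟨ *-congʳ {[ - w ⨾q²]∞ [-q]} ([-q]-homo x [ y ⨾q²]∞) ⟩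
      x [-q] * [ y ⨾q²]∞ [-q] * [ - w ⨾q²]∞ [-q]
        ≈⟨ *-cong {x [-q] * [ y ⨾q²]∞ [-q]} {p ^ n * poch (p ^ suc n)}
                  {[ - w ⨾q²]∞ [-q]} {poch (q * p ^ n)}
             (*-cong {x [-q]} {p ^ n} {[ y ⨾q²]∞ [-q]} {poch (p ^ suc n)} x≈ y≈) w≈ ⟩
      p ^ n * poch (p ^ suc n) * poch (q * p ^ n) ∎
      where
      x = R.1# q^ (2 ℕ.* n)
      y = R.1# q^ (2 ℕ.* n ℕ.+ 2)
      w = R.1# q^ (2 ℕ.* n ℕ.+ 1)
      x≈ : x [-q] ≈ p ^ n
      x≈ = begin
        x [-q]             ≈⟨ [-q]-cong (1q^≈p^ n) ⟩
        (p ^ n) [-q]       ≈⟨ [-q]-p^ n ⟩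
        p ^ n              ∎
      2n+2 : ∀ n → 2 ℕ.* n ℕ.+ 2 ≡ 2 ℕ.* suc n
      2n+2 = ℕ-solve-∀
      y≈ : [ y ⨾q²]∞ [-q] ≈ poch (p ^ suc n)
      y≈ = begin
        [ y ⨾q²]∞ [-q]                ≈⟨ [-q]-⨾q² y ⟩
        poch (y [-q])                 ≈⟨ poch-cong {y [-q]} {p ^ suc n} (begin
          y [-q]                        ≡⟨ ≡.cong (λ m → (R.1# q^ m) [-q]) (2n+2 n) ⟩
          (R.1# q^ (2 ℕ.* suc n)) [-q]  ≈⟨ [-q]-cong (1q^≈p^ (suc n)) ⟩
          (p ^ suc n) [-q]              ≈⟨ [-q]-p^ (suc n) ⟩
          p ^ suc n                     ∎) ⟩
        poch (p ^ suc n)              ∎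
      w≈qp^ : w ≈ q * p ^ n
      w≈qp^ = begin
        R.1# q^ (2 ℕ.* n ℕ.+ 1)       ≡⟨ ≡.cong (R.1# q^_) (ℕ.+-comm (2 ℕ.* n) 1) ⟩
        R.1# q^ suc (2 ℕ.* n)         ≈⟨ q^≈1q^ (suc (2 ℕ.* n)) ⟨
        q * q ^ (2 ℕ.* n)             ≈⟨ *-congˡ {q} (q^≈1q^ (2 ℕ.* n)) ⟩
        q * (R.1# q^ (2 ℕ.* n))       ≈⟨ *-congˡ {q} (1q^≈p^ n) ⟩
        q * p ^ n                     ∎
      w≈ : [ - w ⨾q²]∞ [-q] ≈ poch (q * p ^ n)
      w≈ = begin
        [ - w ⨾q²]∞ [-q]              ≈⟨ [-q]-⨾q² (- w) ⟩
        poch ((- w) [-q])             ≈⟨ poch-cong {(- w) [-q]} {q * p ^ n} (begin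
          (- w) [-q]                    ≈⟨ (λ m _ → [-q]-neg w m) ⟩
          - (w [-q])                    ≈⟨ -‿cong ([-q]-cong w≈qp^) ⟩
          - ((q * p ^ n) [-q])          ≈⟨ -‿cong ([-q]-homo q (p ^ n)) ⟩
          - (q [-q] * (p ^ n) [-q])
            ≈⟨ -‿cong (*-cong {q [-q]} { - q} {(p ^ n) [-q]} {p ^ n} [-q]-q ([-q]-p^ n)) ⟩
          - (- q * p ^ n)
            ≈⟨ solve 2 (λ q x → :- (:- q :* x) := q :* x) refl q (p ^ n) ⟩
          q * p ^ n                     ∎) ⟩
        poch (q * p ^ n)              ∎

    term-vanishes : ∀ ν n → n < ν → term (suc ν) n R.≈ R.0#
    term-vanishes ν n n<ν = R.trans
      (*-commutative (x * e * o) (divisor (suc ν) ⁻¹) n)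
      (product-vanishes (divisor (suc ν) ⁻¹) (x * e * o) (λ k k<ν → R.trans
        (*-commutative (x * e) o k)
        (product-vanishes o (x * e) (λ k k<ν → R.trans
          (*-commutative x e k)
          (product-vanishes e x (λ _ → q^-> R.1#) k k<ν)) k k<ν)) n
        (ℕ.<-≤-trans n<ν (ℕ.≤-trans (ℕ.n≤1+n ν) (ℕ.m≤m+n (suc ν) (suc ν ℕ.+ 0)))))
      where
      x = R.1# q^ (2 ℕ.* suc ν)
      e = [ R.1# q^ (2 ℕ.* suc ν ℕ.+ 2) ⨾q²]∞
      o = [ - (R.1# q^ (2 ℕ.* suc ν ℕ.+ 1)) ⨾q²]∞

    product-side :
      [ z ⨾q²]∞ * [ z⁻¹ ⨾q²]∞ * [ R.1# q^ 2 ⨾q²]∞ * ∑∞ (λ ν → term (suc ν)) [-q] ≈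
      ∑< (suc N) (λ n → ∑< (suc n) (λ m → F z z⁻¹ zz⁻¹≈1 (n ∸ m) m))
    product-side = begin
      [ z ⨾q²]∞ * [ z⁻¹ ⨾q²]∞ * [ R.1# q^ 2 ⨾q²]∞ * ∑∞ (λ ν → term (suc ν)) [-q]
        ≈⟨ *-cong {[ z ⨾q²]∞ * [ z⁻¹ ⨾q²]∞ * [ R.1# q^ 2 ⨾q²]∞} {poch z * poch z⁻¹ * poch p}
                  {∑∞ (λ ν → term (suc ν)) [-q]} {∑< (suc N) t}
             (*-cong {[ z ⨾q²]∞ * [ z⁻¹ ⨾q²]∞} {poch z * poch z⁻¹} {[ R.1# q^ 2 ⨾q²]∞} {poch p}
               (*-cong {[ z ⨾q²]∞} {poch z} {[ z⁻¹ ⨾q²]∞} {poch z⁻¹} (⨾q²-poch z) (⨾q²-poch z⁻¹))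
               p≈)
             (trans ([-q]-cong (∑∞-truncated N (λ ν → term (suc ν)) term-vanishes))
                    ([-q]-∑< (suc N) (λ ν → term (suc ν)))) ⟩
      poch z * poch z⁻¹ * poch p * ∑< (suc N) t
        ≈⟨ spt-crank t (λ ν → begin
             denominator (suc ν) * t ν             ≈⟨ *-congʳ {t ν} ([-q]-divisor (suc ν)) ⟨
             divisor (suc ν) [-q] * t ν            ≈⟨ [-q]-homo (divisor (suc ν)) (term (suc ν)) ⟨
             (divisor (suc ν) * term (suc ν)) [-q] ≈⟨ [-q]-cong (divisor*term ν) ⟩
             numerator (suc ν) [-q]                ≈⟨ [-q]-numerator (suc ν) ⟩
             p ^ suc ν * poch (p ^ suc (suc ν)) * poch (q * p ^ suc ν) ∎) ⟩
      ∑< (suc N) (λ n → ∑< (suc n) (λ m → F z z⁻¹ zz⁻¹≈1 (n ∸ m) m)) ∎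
      where
      t = λ ν → term (suc ν) [-q]
      p≈ : [ R.1# q^ 2 ⨾q²]∞ ≈ poch p
      p≈ = begin
        [ R.1# q^ 2 ⨾q²]∞     ≈⟨ ⨾q²-poch (R.1# q^ 2) ⟩
        poch (R.1# q^ 2)      ≈⟨ poch-cong {R.1# q^ 2} {p} (begin
          R.1# q^ 2             ≈⟨ 1q^≈p^ 1 ⟩
          p ^ 1                 ≈⟨ *-identityʳ p ⟩
          p                     ∎) ⟩
        poch p                ∎

    -- `x n m` and `y n m` stand for zⁿ⁻ᵐ and zᵐ⁻ⁿ, whose exponents are integers. Only n = k + m
    -- matters, where they are natural powers of `z` and `z⁻¹`.
    double-sum-side : (x y : ℕ → ℕ → Series) →
      (∀ k m → x (k ℕ.+ m) m ≈ z ^ k) → (∀ k m → y (k ℕ.+ m) m ≈ z⁻¹ ^ k) →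
      ∑∞ (λ n → ∑≤ n (λ m →
        (- 1#) ^ₛ n * (1# - x n m) ^ₛ 2 * y n m * (R.1# q^ exponent n m))) ≈
      ∑< (suc N) (λ n → ∑< (suc n) (λ m → F z z⁻¹ zz⁻¹≈1 (n ∸ m) m))
    double-sum-side x y x≈ y≈ = begin
      ∑∞ (λ n → ∑≤ n (s n))
        ≈⟨ ∑∞-truncated N (λ n → ∑≤ n (s n)) vanishes ⟩
      ∑< (suc N) (λ n → ∑≤ n (s n))
        ≈⟨ ∑<-cong (suc N) (λ n _ → begin
             ∑≤ n (s n)           ≡⟨ ∑≤-∑< N n (s n) ⟩
             ∑< (suc n) (s n)     ≈⟨ ∑<-cong (suc n) (λ m m≤n → begin
               s n m
                 ≡⟨ ≡.cong (λ n → s n m) (ℕ.m∸n+n≡m (ℕ.≤-pred m≤n)) ⟨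
               s (n ∸ m ℕ.+ m) m  ≈⟨ s≈F (n ∸ m) m ⟩
               F z z⁻¹ zz⁻¹≈1 (n ∸ m) m ∎) ⟩
             ∑< (suc n) (λ m → F z z⁻¹ zz⁻¹≈1 (n ∸ m) m) ∎) ⟩
      ∑< (suc N) (λ n → ∑< (suc n) (λ m → F z z⁻¹ zz⁻¹≈1 (n ∸ m) m)) ∎
      where
      s : ℕ → ℕ → Series
      s n m = (- 1#) ^ₛ n * (1# - x n m) ^ₛ 2 * y n m * (R.1# q^ exponent n m)

      vanishes : ∀ n k → k < n → ∑≤ n (s n) k R.≈ R.0#
      vanishes n k k<n = R.trans (R.reflexive (∑≤-coefficient n (s n) k))
        (FiniteSums.∑<-zero R (suc n) (λ m m≤n → product-vanishes
          ((- 1#) ^ₛ n * (1# - x n m) ^ₛ 2 * y n m) (R.1# q^ exponent n m)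
          (λ _ j< → q^-> R.1# (ℕ.<-≤-trans j< (n≤exponent n m (ℕ.≤-pred m≤n)))) k k<n))

      s≈F : ∀ k m → s (k ℕ.+ m) m ≈ F z z⁻¹ zz⁻¹≈1 k m
      s≈F k m = begin
        (- 1#) ^ₛ (k ℕ.+ m) * ((1# - X) * ((1# - X) * 1#)) * Y * (R.1# q^ exponent (k ℕ.+ m) m)
          ≈⟨ *-cong {(- 1#) ^ₛ (k ℕ.+ m) * ((1# - X) * ((1# - X) * 1#)) * Y}
                    {a * ((1# - z ^ k) * ((1# - z ^ k) * 1#)) * z⁻¹ ^ k}
                    {R.1# q^ exponent (k ℕ.+ m) m} {e}
               (*-cong {(- 1#) ^ₛ (k ℕ.+ m) * ((1# - X) * ((1# - X) * 1#))}
                       {a * ((1# - z ^ k) * ((1# - z ^ k) * 1#))} {Y} {z⁻¹ ^ k}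
                 (*-cong {(- 1#) ^ₛ (k ℕ.+ m)} {a}
                         {(1# - X) * ((1# - X) * 1#)} {(1# - z ^ k) * ((1# - z ^ k) * 1#)}
                   (reflexive (^ₛ-^ (- 1#) (k ℕ.+ m)))
                   (*-cong {1# - X} {1# - z ^ k} {(1# - X) * 1#} {(1# - z ^ k) * 1#} 1-X≈
                     (*-congʳ {1#} {1# - X} {1# - z ^ k} 1-X≈)))
                 (y≈ k m))
               e≈ ⟩
        a * ((1# - z ^ k) * ((1# - z ^ k) * 1#)) * z⁻¹ ^ k * e
          -- The expansion of (1 - zᵏ)² z⁻ᵏ is grouped so that each zᵏ z⁻ᵏ can be replaced by 1,
          -- which leaves zᵏ + z⁻ᵏ - 2.
          ≈⟨ solve 4 (λ a x y e → a :* ((𝟙 :- x) :* ((𝟙 :- x) :* 𝟙)) :* y :* e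
               := (y :- 𝟚 :* (x :* y) :+ x :* (x :* y)) :* (a :* e)) refl a (z ^ k) (z⁻¹ ^ k) e ⟩
        (z⁻¹ ^ k - (1# + 1#) * (z ^ k * z⁻¹ ^ k) + z ^ k * (z ^ k * z⁻¹ ^ k)) * (a * e)
          ≈⟨ *-congʳ {a * e} (+-cong
               {z⁻¹ ^ k - (1# + 1#) * (z ^ k * z⁻¹ ^ k)} {z⁻¹ ^ k - (1# + 1#) * 1#}
               {z ^ k * (z ^ k * z⁻¹ ^ k)} {z ^ k * 1#}
               (+-congˡ {z⁻¹ ^ k} (-‿cong (*-congˡ {1# + 1#} (z^k*z⁻¹^k k))))
               (*-congˡ {z ^ k} (z^k*z⁻¹^k k))) ⟩
        (z⁻¹ ^ k - (1# + 1#) * 1# + z ^ k * 1#) * (a * e)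
          ≈⟨ solve 4 (λ a x y e → (y :- 𝟚 :* 𝟙 :+ x :* 𝟙) :* (a :* e)
               := (x :+ y :- 𝟚) :* (a :* e)) refl a (z ^ k) (z⁻¹ ^ k) e ⟩
        F z z⁻¹ zz⁻¹≈1 k m ∎
        where
        X = x (k ℕ.+ m) m
        Y = y (k ℕ.+ m) m
        a = (- 1#) ^ (k ℕ.+ m)
        d = k ℕ.* k ℕ.+ k ℕ.+ (triangular m ℕ.+ m ℕ.* (k ℕ.+ k))
        e = q ^ d
        1-X≈ : 1# - X ≈ 1# - z ^ k
        1-X≈ = +-congˡ {1#} (-‿cong (x≈ k m))
        e≈ : R.1# q^ exponent (k ℕ.+ m) m ≈ e
        e≈ = trans (reflexive (≡.cong (R.1# q^_) (exponent-+ k m))) (sym (q^≈1q^ d))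
        z^k*z⁻¹^k : ∀ k → z ^ k * z⁻¹ ^ k ≈ 1#
        z^k*z⁻¹^k zero    = *-identityˡ 1#
        z^k*z⁻¹^k (suc k) = begin
          z * z ^ k * (z⁻¹ * z⁻¹ ^ k)
            ≈⟨ solve 4 (λ z w x y → z :* x :* (w :* y) := z :* w :* (x :* y)) refl
                 z z⁻¹ (z ^ k) (z⁻¹ ^ k) ⟩
          z * z⁻¹ * (z ^ k * z⁻¹ ^ k)
            ≈⟨ *-cong {z * z⁻¹} {1#} {z ^ k * z⁻¹ ^ k} {1#} zz⁻¹≈1 (z^k*z⁻¹^k k) ⟩
          1# * 1#                       ≈⟨ *-identityˡ 1# ⟩
          1#                            ∎

    product≈double-sum : (x y : ℕ → ℕ → Series) →
      (∀ k m → x (k ℕ.+ m) m ≈ z ^ k) → (∀ k m → y (k ℕ.+ m) m ≈ z⁻¹ ^ k) →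
      [ z ⨾q²]∞ * [ z⁻¹ ⨾q²]∞ * [ R.1# q^ 2 ⨾q²]∞ * ∑∞ (λ ν → term (suc ν)) [-q] ≈
      ∑∞ (λ n → ∑≤ n (λ m →
        (- 1#) ^ₛ n * (1# - x n m) ^ₛ 2 * y n m * (R.1# q^ exponent n m)))
    product≈double-sum x y x≈ y≈ n n≤N =
      R.trans (product-side n n≤N) (R.sym (double-sum-side x y x≈ y≈ n n≤N))

-- The theorem over the Laurent polynomials

open import Defs

private
  module Trunc (N : ℕ) = CommutativeRing (SeriesRing.truncated LaurentRing.commutativeRing N)
  module TruncExp (N : ℕ) = Algebra.Properties.Semiring.Exp (Trunc.semiring N)

z^-power : ∀ N i k {j} → j ≡ i ℤ.* + k → Trunc._≈_ N (z^ j) (TruncExp._^_ N (z^ i) k)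
z^-power N i zero    ≡.refl = Trunc.reflexive N (≡.cong z^_ (ℤ.*-zeroʳ i))
z^-power N i (suc k) ≡.refl = begin
  z^ (i ℤ.* + suc k)             ≡⟨ ≡.cong z^_ (ℤ.*-suc i (+ k)) ⟩
  z^ (i ℤ.+ i ℤ.* + k)           ≈⟨ (λ n _ → q^-* [ 1ℤ , i ] [ 1ℤ , i ℤ.* + k ] 0 0 n) ⟨
  z^ i * z^ (i ℤ.* + k)
    ≈⟨ Trunc.*-congˡ N {z^ i} {z^ (i ℤ.* + k)} {TruncExp._^_ N (z^ i) k} (z^-power N i k ≡.refl) ⟩
  z^ i * TruncExp._^_ N (z^ i) k ∎
  where
  open SeriesRing LaurentRing.commutativeRing using (q^-*)
  open Relation.Binary.Reasoning.Setoid (Trunc.setoid N)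

theorem6p3 : [ z ⨾q²]∞ * [ z⁻¹ ⨾q²]∞ * [ q^ 2 ⨾q²]∞ * S2 [-q]
    ≈ ∑∞ (λ n → ∑≤ n (λ m →
    (- 1#) ^ n * (1# - z^ (+ n ℤ.- + m)) ^ 2 * z^ (+ m ℤ.- + n) * q^ (exponent n m)))
-- The coefficient of qᴺ is taken from the identity modulo qᴺ⁺¹, so each N uses its own truncation.
theorem6p3 N = product≈double-sum [ 1ℤ , 1ℤ ] [ 1ℤ , -1ℤ ] (λ _ → ≡.refl)
  (λ n m → z^ (+ n ℤ.- + m)) (λ n m → z^ (+ m ℤ.- + n))
  (λ k m → z^-power N 1ℤ k ([k+m]-m (+ k) (+ m)))
  (λ k m → z^-power N -1ℤ k (m-[k+m] (+ k) (+ m)))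
  N ℕ.≤-refl
  where
  open TruncatedSeries LaurentRing.commutativeRing N
  [k+m]-m : ∀ k m → k ℤ.+ m ℤ.- m ≡ 1ℤ ℤ.* k
  [k+m]-m = ℤ-solve-∀
  m-[k+m] : ∀ k m → m ℤ.- (k ℤ.+ m) ≡ -1ℤ ℤ.* k
  m-[k+m] = ℤ-solve-∀
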